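{- For all integers $k \geq 3$ and $m \geq 3$, $$R(K_{3,m},K_{3,m}) + 2(k-2) \leq gr_k(K_3 : K_{3,m}) \leq \max\{6m-2,\ R(K_{3,m},K_{3,m})\} + 2(k-2).$$
   Context: $K_{3,m}$ is the complete bipartite graph with parts of sizes $3$ and $m$. $R(H,H)$ is the least $n$ such that every red/blue coloring of the edges of $K_n$ contains a monochromatic copy of $H$. A rainbow triangle is a triangle whose three edges have three distinct colors. $gr_k(K_3 : H)$ is the minimum integer $n$ such that every $k$-coloring of the edges of $K_n$ (using all $k$ colors) contains either a rainbow triangle or a monochromatic copy of $H$. -}

module Defs where

open import Data.Nat using (ℕ; _≤_; _<_)
open import Data.Fin using (Fin)
open import Data.Sum using (_⊎_)
open import Data.Product using (Σ; _×_; ∃)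
open import Relation.Binary.PropositionalEquality using (_≡_; _≢_)
open import Relation.Nullary using (¬_)
open import Function.Definitions using (Injective)

-- An edge colouring of the complete graph K_n with colours in Fin k:
-- a symmetric function on pairs of distinct vertices (values on the
-- diagonal are irrelevant and never inspected).
record Colouring (n k : ℕ) : Set where
  field
    col : Fin n → Fin n → Fin k
    sym : ∀ i j → i ≢ j → col i j ≡ col j i
open Colouring public

UsesAllColours : ∀ {n k} → Colouring n k → Set
UsesAllColours {n} {k} c =
  ∀ (x : Fin k) → Σ (Fin n) λ i → Σ (Fin n) λ j → (i ≢ j) × (col c i j ≡ x)

HasRainbowTriangle : ∀ {n k} → Colouring n k → Set
HasRainbowTriangle {n} c =
  Σ (Fin n) λ a → Σ (Fin n) λ b → Σ (Fin n) λ d →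
    (a ≢ b) × (b ≢ d) × (a ≢ d) ×
    (col c a b ≢ col c b d) × (col c b d ≢ col c a d) × (col c a b ≢ col c a d)

HasMonoK3m : ∀ {n k} → ℕ → Colouring n k → Set
HasMonoK3m {n} {k} m c =
  Σ (Fin 3 → Fin n) λ f → Σ (Fin m → Fin n) λ g → Σ (Fin k) λ x →
    Injective _≡_ _≡_ f × Injective _≡_ _≡_ g ×
    (∀ a b → f a ≢ g b) × (∀ a b → col c (f a) (g b) ≡ x)

RamseyProp : ℕ → ℕ → Set
RamseyProp m n = (c : Colouring n 2) → HasMonoK3m m c

IsRamseyK3m : ℕ → ℕ → Set
IsRamseyK3m m r = RamseyProp m r × (∀ n → n < r → ¬ RamseyProp m n)

GRProp : ℕ → ℕ → ℕ → Set
GRProp k m n = ∀ N → n ≤ N → (c : Colouring N k) → UsesAllColours c →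
  HasRainbowTriangle c ⊎ HasMonoK3m m c

IsGR : ℕ → ℕ → ℕ → Set
IsGR k m g = GRProp k m g × (∀ n → n < g → ¬ GRProp k m n)

{-# OPTIONS --safe #-}

-- Lower bound: to a 2-colouring of K_{r-1} without a monochromatic K_{3,m} add, for each further
-- colour, two vertices joined to everything in that colour.
--
-- Upper bound: let W be a minimal set of at least m vertices such that every outside vertex sees
-- W in one colour; each colour then occurs for at most two outside vertices. Gallai's theorem
-- splits W into blocks with only two colours p, q between them. No block has m or more
-- vertices by minimality, and a block of size at least 3 leaves room for only 3m - 3 vertices, so all
-- blocks have size at most 2. If two outside vertices see W in p, then p is sparse in W and q
-- contains K_{3,m}. Otherwise the outside vertices seeing W in p or q can be added to W as
-- singleton blocks, which leaves at most 2(k-2) vertices out. If all blocks are singletons,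
-- this set is 2-coloured and has at least r vertices. A block of size 2 has a p- and a
-- q-neighbourhood with at least 6m - 4 vertices in total, where p respectively q is sparse and between
-- which each vertex has few edges of its own type; counting those edges gives a contradiction.
module Submission where

open import Defs
open import Data.Nat using (ℕ; zero; suc; _+_; _*_; _∸_; _⊔_; _^_; _≤_; _<_; z≤n; s≤s; _≤?_)
import Data.Nat.Properties as ℕₚ
open import Data.Nat.Tactic.RingSolver using (solve-∀)
open import Data.Fin
  using (Fin; zero; suc; _≟_; funToFin; finToFun; inject≤; join; splitAt; punchOut; _↑ˡ_; _↑ʳ_)
open import Data.Fin.Properties
  using (any?; all?; suc-injective; 0≢1+n; finToFun-funToFin; injective⇒≤; inject≤-injective;
         ↑ˡ-injective; ↑ʳ-injective; splitAt-↑ˡ; splitAt-↑ʳ; join-splitAt; punchOut-injective)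
open import Data.Product using (Σ; ∃; _×_; _,_; proj₁; proj₂)
open import Data.Sum as Sum using (_⊎_; inj₁; inj₂; [_,_]′)
open import Data.Empty using (⊥; ⊥-elim)
open import Data.Unit using (⊤; tt)
open import Data.List using (List; []; _∷_; filter; allFin; cartesianProduct)
open import Data.List.Membership.Propositional using (_∈_)
open import Data.List.Membership.Propositional.Properties
  using (∈-filter⁺; ∈-filter⁻; ∈-allFin; ∈-cartesianProduct⁺)
open import Data.List.Membership.DecPropositional using () renaming (_∈?_ to member?)
open import Data.List.Relation.Unary.Any using (here; there)
open import Data.Vec using (lookup; []; _∷_)
open import Function using (_∘_; id)
open import Function.Definitions using (Injective)
open import Level using (0ℓ)
open import Relation.Nullary using (¬_; Dec; yes; no; ¬?; _×-dec_; _⊎-dec_; _→-dec_; map′)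
open import Relation.Nullary.Decidable using (decidable-stable)
open import Relation.Unary using (Pred; Decidable; _⊆_; _∪_)
open import Relation.Unary.Properties using (_∪?_) renaming (U? to univ?)
open import Relation.Binary.Core using (Rel)
open import Relation.Binary.Definitions
  using (Symmetric; Reflexive) renaming (Decidable to Decidable₂)
open import Relation.Binary.Construct.Closure.ReflexiveTransitive
  using (Star; ε; _◅_; _◅◅_; reverse; return) renaming (map to map⋆)
open import Relation.Binary.PropositionalEquality as ≡
  using (_≡_; _≢_; _≗_; refl; trans; cong; cong₂)
open import Algebra.Properties.Semiring.Sum ℕₚ.+-*-semiring
  using (sum; ∑-distrib-+; ∑-comm; *-distribʳ-sum)

private
  variable
    n k : ℕ
    P Q R : Pred (Fin n) 0ℓ


-- Finite sums and the counting of decidable predicates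

sum-mono-≤ : {f g : Fin n → ℕ} → (∀ i → f i ≤ g i) → sum f ≤ sum g
sum-mono-≤ {zero}  f≤g = z≤n
sum-mono-≤ {suc n} f≤g = ℕₚ.+-mono-≤ (f≤g zero) (sum-mono-≤ (f≤g ∘ suc))

term≤sum : (f : Fin n → ℕ) → ∀ i → f i ≤ sum f
term≤sum f zero    = ℕₚ.m≤m+n _ _
term≤sum f (suc i) = ℕₚ.m≤n⇒m≤o+n (f zero) (term≤sum (f ∘ suc) i)

sum-const : ∀ n c → sum {n} (λ _ → c) ≡ n * c
sum-const zero    c = refl
sum-const (suc n) c = cong (c +_) (sum-const n c)

⟦_⟧ : ∀ {A : Set} → Dec A → ℕ
⟦ yes _ ⟧ = 1
⟦ no _ ⟧  = 0

⟦⟧-yes : ∀ {A : Set} (A? : Dec A) → A → ⟦ A? ⟧ ≡ 1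
⟦⟧-yes (yes _) a = refl
⟦⟧-yes (no ¬a) a = ⊥-elim (¬a a)

⟦⟧-no : ∀ {A : Set} (A? : Dec A) → ¬ A → ⟦ A? ⟧ ≡ 0
⟦⟧-no (yes a) ¬a = ⊥-elim (¬a a)
⟦⟧-no (no _)  ¬a = refl

⟦⟧≤ : ∀ {A : Set} (A? : Dec A) {c} → (A → 1 ≤ c) → ⟦ A? ⟧ ≤ c
⟦⟧≤ (yes a) h = h a
⟦⟧≤ (no _)  h = z≤n

# : Decidable P → ℕ
# P? = sum (λ i → ⟦ P? i ⟧)

#-mono : (P? : Decidable P) (Q? : Decidable Q) → P ⊆ Q → # P? ≤ # Q?
#-mono P? Q? P⊆Q = sum-mono-≤ λ i →
  ⟦⟧≤ (P? i) λ p → ℕₚ.≤-reflexive (≡.sym (⟦⟧-yes (Q? i) (P⊆Q p)))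

#-∪ : (P? : Decidable P) (Q? : Decidable Q) → # (P? ∪? Q?) ≤ # P? + # Q?
#-∪ P? Q? = ℕₚ.≤-trans (sum-mono-≤ λ i → ⟦∪⟧ (P? i) (Q? i))
                       (ℕₚ.≤-reflexive (∑-distrib-+ (λ i → ⟦ P? i ⟧) (λ i → ⟦ Q? i ⟧)))
  where
  ⟦∪⟧ : ∀ {A B : Set} (A? : Dec A) (B? : Dec B) → ⟦ A? ⊎-dec B? ⟧ ≤ ⟦ A? ⟧ + ⟦ B? ⟧
  ⟦∪⟧ (yes _) B?      = s≤s z≤n
  ⟦∪⟧ (no _)  (yes _) = s≤s z≤n
  ⟦∪⟧ (no _)  (no _)  = z≤n

#-cover : (P? : Decidable P) (Q? : Decidable Q) (R? : Decidable R) → P ⊆ Q ∪ R →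
          # P? ≤ # Q? + # R?
#-cover P? Q? R? P⊆ = ℕₚ.≤-trans (#-mono P? (Q? ∪? R?) P⊆) (#-∪ Q? R?)

#-disjoint : (P? : Decidable P) (Q? : Decidable Q) (R? : Decidable R) →
             P ⊆ R → Q ⊆ R → (∀ i → P i → ¬ Q i) → # P? + # Q? ≤ # R?
#-disjoint P? Q? R? P⊆R Q⊆R dis = ℕₚ.≤-trans
  (ℕₚ.≤-reflexive (≡.sym (∑-distrib-+ (λ i → ⟦ P? i ⟧) (λ i → ⟦ Q? i ⟧))))
  (sum-mono-≤ λ i → ptw (P? i) (Q? i) (R? i) P⊆R Q⊆R (dis i))
  where
  ptw : ∀ {A B C : Set} (A? : Dec A) (B? : Dec B) (C? : Dec C) →
        (A → C) → (B → C) → (A → ¬ B) → ⟦ A? ⟧ + ⟦ B? ⟧ ≤ ⟦ C? ⟧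
  ptw (yes a) (yes b) C?      f g h = ⊥-elim (h a b)
  ptw (yes a) (no _)  C?      f g h = ℕₚ.≤-reflexive (≡.sym (⟦⟧-yes C? (f a)))
  ptw (no _)  (yes b) C?      f g h = ℕₚ.≤-reflexive (≡.sym (⟦⟧-yes C? (g b)))
  ptw (no _)  (no _)  C?      f g h = z≤n

#-all : (P? : Decidable P) → (∀ i → P i) → # {n} P? ≡ n
#-all {n = zero}  P? all = refl
#-all {n = suc n} P? all rewrite ⟦⟧-yes (P? zero) (all zero) =
  cong suc (#-all (P? ∘ suc) (all ∘ suc))

#-none : (P? : Decidable P) → (∀ i → ¬ P i) → # {n} P? ≡ 0
#-none {n = zero}  P? none = refl
#-none {n = suc n} P? none rewrite ⟦⟧-no (P? zero) (none zero) =
  #-none (P? ∘ suc) (none ∘ suc)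

#-complement : (P? : Decidable P) → n ≤ # {n} P? + # (λ i → ¬? (P? i))
#-complement {n = zero}  P? = z≤n
#-complement {n = suc n} P? with P? zero
... | yes _ = s≤s (#-complement (P? ∘ suc))
... | no _  = ℕₚ.≤-trans (s≤s (#-complement (P? ∘ suc)))
                (ℕₚ.≤-reflexive (≡.sym (ℕₚ.+-suc (# (P? ∘ suc)) (# (λ i → ¬? (P? (suc i)))))))

#-≟ : (i : Fin n) → # (_≟ i) ≡ 1
#-≟ {suc n} zero    = cong suc (#-none {n} (λ j → suc j ≟ zero) (λ _ ()))
#-≟ {suc n} (suc i) = trans
  (ℕₚ.≤-antisym
    (#-mono (λ j → suc j ≟ suc i) (_≟ i) suc-injective)
    (#-mono (_≟ i) (λ j → suc j ≟ suc i) (cong suc)))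
  (#-≟ i)

-- Turns lower bounds on counts into distinct vertices, from which copies of K_{3,m} are assembled.
pick : ∀ m (P? : Decidable P) → m ≤ # P? →
       Σ (Fin m → Fin n) λ g → Injective _≡_ _≡_ g × (∀ i → P (g i))
pick zero P? m≤ = (λ ()) , (λ { {()} }) , λ ()
pick {n = suc n} (suc m) P? m≤ with P? zero
... | no _  = let g , inj , h = pick (suc m) (P? ∘ suc) m≤ in
  suc ∘ g , inj ∘ suc-injective , h
... | yes p = g′ , inj′ , h′
  where
  rest = pick m (P? ∘ suc) (ℕₚ.≤-pred m≤)
  g′ : Fin (suc m) → Fin (suc n)
  g′ zero    = zero
  g′ (suc i) = suc (proj₁ rest i)
  inj′ : Injective _≡_ _≡_ g′
  inj′ {zero}  {zero}  e = refl
  inj′ {suc i} {suc j} e = cong suc (proj₁ (proj₂ rest) (suc-injective e))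
  h′ : ∀ i → _
  h′ zero    = p
  h′ (suc i) = proj₂ (proj₂ rest) i

outside : (P? : Decidable P) (Q? : Decidable Q) → # Q? < # P? → ∃ λ i → P i × ¬ Q i
outside P? Q? lt with any? (λ i → P? i ×-dec ¬? (Q? i))
... | yes w = w
... | no ¬w = ⊥-elim (ℕₚ.<⇒≱ lt (#-mono P? Q? λ {i} p →
  decidable-stable (Q? i) λ ¬q → ¬w (i , p , ¬q)))

-- Decidability and existence of the two numbers

-- The search runs over the codes in `Fin (b ^ a)`. Decoding inverts coding only up to pointwise
-- equality, hence the hypothesis `resp`.
anyFun? : ∀ {a b} (P : (Fin a → Fin b) → Set) → (∀ {f g} → f ≗ g → P f → P g) →
          (∀ f → Dec (P f)) → Dec (∃ P)
anyFun? P resp P? = map′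
  (λ (i , p) → finToFun i , p)
  (λ (f , p) → funToFin f , resp (≡.sym ∘ finToFun-funToFin f) p)
  (any? (P? ∘ finToFun))

injective? : ∀ {a b} (f : Fin a → Fin b) → Dec (Injective _≡_ _≡_ f)
injective? f = map′ (λ h {x} {y} → h x y) (λ inj x y → inj {x} {y})
  (all? λ x → all? λ y → (f x ≟ f y) →-dec (x ≟ y))

_≈ᶜ_ : Colouring n k → Colouring n k → Set
c ≈ᶜ d = ∀ i j → col c i j ≡ col d i j

≈ᶜ-sym : {c d : Colouring n k} → c ≈ᶜ d → d ≈ᶜ c
≈ᶜ-sym c≈d i j = ≡.sym (c≈d i j)

-- Each row of the colour matrix is coded by one element of `Fin (k ^ n)`, which reduces the search
-- to `anyFun?`.
anyColouring? : (P : Colouring n k → Set) → (∀ {c d} → c ≈ᶜ d → P c → P d) →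
                (∀ c → Dec (P c)) → Dec (∃ P)
anyColouring? {n} {k} P resp P? = map′
  (λ (r , s , p) → mk r s , p)
  (λ (c , p) → let e : ∀ i j → unfold (fold (col c)) i j ≡ col c i j
                   e i j = unfold-fold (col c) i j
                   s = λ i j i≢j → trans (e i j) (trans (sym c i j i≢j) (≡.sym (e j i)))
               in fold (col c) , s , resp {c} {mk (fold (col c)) s} (λ i j → ≡.sym (e i j)) p)
  (anyFun? Coded coded-resp coded?)
  where
  unfold : (Fin n → Fin (k ^ n)) → Fin n → Fin n → Fin k
  unfold r i = finToFun (r i)
  fold : (Fin n → Fin n → Fin k) → Fin n → Fin (k ^ n)
  fold f i = funToFin (f i)
  unfold-fold : ∀ f i j → unfold (fold f) i j ≡ f i j
  unfold-fold f i = finToFun-funToFin (f i)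
  Sym : (Fin n → Fin (k ^ n)) → Set
  Sym r = ∀ i j → i ≢ j → unfold r i j ≡ unfold r j i
  mk : ∀ r → Sym r → Colouring n k
  mk r s = record { col = unfold r ; sym = s }
  Coded : (Fin n → Fin (k ^ n)) → Set
  Coded r = Σ (Sym r) λ s → P (mk r s)
  coded-resp : ∀ {r r′} → r ≗ r′ → Coded r → Coded r′
  coded-resp {r} {r′} e (s , p) = s′ , resp {mk r s} {mk r′ s′} ee p
    where
    ee : ∀ i j → unfold r i j ≡ unfold r′ i j
    ee i j = cong (λ t → finToFun t j) (e i)
    s′ : Sym r′
    s′ i j i≢j = trans (≡.sym (ee i j)) (trans (s i j i≢j) (ee j i))
  coded? : ∀ r → Dec (Coded r)
  coded? r with all? (λ i → all? λ j → ¬? (i ≟ j) →-dec (unfold r i j ≟ unfold r j i))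
  ... | no ¬s = no (¬s ∘ proj₁)
  -- The symmetry proof does not affect the colours, so testing `P` with this one settles all
  -- others.
  ... | yes s = map′ (s ,_) (λ (s′ , p) → resp {mk r s′} {mk r s} (λ _ _ → refl) p) (P? (mk r s))

mono-resp : ∀ {m} {c d : Colouring n k} → c ≈ᶜ d → HasMonoK3m m c → HasMonoK3m m d
mono-resp c≈d (f , g , x , fi , gi , dis , mono) =
  f , g , x , fi , gi , dis , λ a b → trans (≡.sym (c≈d _ _)) (mono a b)

hasMono? : ∀ m (c : Colouring n k) → Dec (HasMonoK3m m c)
hasMono? m c =
  anyFun? _
    (λ { {f} {f′} e (g , x , fi , gi , dis , mono) → g , x ,
         (λ eq → fi (trans (e _) (trans eq (≡.sym (e _))))) , gi ,
         (λ a b eq → dis a b (trans (e a) eq)) ,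
         λ a b → trans (cong (λ v → col c v (g b)) (≡.sym (e a))) (mono a b) })
    λ f → anyFun? _
      (λ { {g} {g′} e (x , fi , gi , dis , mono) → x , fi ,
           (λ eq → gi (trans (e _) (trans eq (≡.sym (e _))))) ,
           (λ a b eq → dis a b (trans eq (≡.sym (e b)))) ,
           λ a b → trans (cong (col c (f a)) (≡.sym (e b))) (mono a b) })
      λ g → any? λ x → injective? f ×-dec injective? g ×-dec
        (all? λ a → all? λ b → ¬? (f a ≟ g b)) ×-dec
        (all? λ a → all? λ b → col c (f a) (g b) ≟ x)

usesAll? : (c : Colouring n k) → Dec (UsesAllColours c)
usesAll? c = all? λ x → any? λ i → any? λ j → ¬? (i ≟ j) ×-dec (col c i j ≟ x)

hasRainbow? : (c : Colouring n k) → Dec (HasRainbowTriangle c)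
hasRainbow? c = any? λ a → any? λ b → any? λ d →
  ¬? (a ≟ b) ×-dec ¬? (b ≟ d) ×-dec ¬? (a ≟ d) ×-dec
  ¬? (col c a b ≟ col c b d) ×-dec ¬? (col c b d ≟ col c a d) ×-dec
  ¬? (col c a b ≟ col c a d)

-- The colourings witnessing gr_k(K₃ : K_{3,m}) > n.
Avoiding : ℕ → Colouring n k → Set
Avoiding m c = UsesAllColours c × ¬ HasRainbowTriangle c × ¬ HasMonoK3m m c

avoiding? : ∀ m → Dec (Σ (Colouring n k) (Avoiding m))
avoiding? {n} {k} m = anyColouring? (Avoiding m) (λ {c} {d} → resp {c} {d})
  λ c → usesAll? c ×-dec ¬? (hasRainbow? c) ×-dec ¬? (hasMono? m c)
  where
  resp : ∀ {c d : Colouring n k} → c ≈ᶜ d → Avoiding m c → Avoiding m d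
  resp {c} {d} e (u , ¬r , ¬m) =
    (λ x → let i , j , i≢j , p = u x in i , j , i≢j , trans (≡.sym (e i j)) p) ,
    (λ (a , b , v , a≢b , b≢v , a≢v , p , q , s) → ¬r (a , b , v , a≢b , b≢v , a≢v ,
       (λ z → p (trans (≡.sym (e a b)) (trans z (e b v)))) ,
       (λ z → q (trans (≡.sym (e b v)) (trans z (e a v)))) ,
       (λ z → s (trans (≡.sym (e a b)) (trans z (e a v)))))) ,
    ¬m ∘ mono-resp {c = d} {d = c} (≈ᶜ-sym {c = c} {d = d} e)

monoFree? : ∀ m → Dec (Σ (Colouring n k) λ c → ¬ HasMonoK3m m c)
monoFree? m = anyColouring? _
  (λ {c} {d} e → _∘ mono-resp {c = d} {d = c} (≈ᶜ-sym {c = c} {d = d} e))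
  (¬? ∘ hasMono? m)

-- Colourings form a finite search space, so failure of the universal statement yields an actual
-- counterexample.
monoFree : ∀ {m} → ¬ RamseyProp m n → Σ (Colouring n 2) λ c → ¬ HasMonoK3m m c
monoFree {m = m} ¬ram = decidable-stable (monoFree? m) λ none →
  ¬ram λ c → decidable-stable (hasMono? m c) λ ¬mono → none (c , ¬mono)

ramseyProp? : ∀ m n → Dec (RamseyProp m n)
ramseyProp? m n = map′
  (λ none c → decidable-stable (hasMono? m c) λ ¬mono → none (c , ¬mono))
  (λ ram (c , ¬mono) → ¬mono (ram c))
  (¬? (monoFree? m))

least : {P : ℕ → Set} → Decidable P → ∀ n → P n → Σ ℕ λ r → P r × (∀ i → i < r → ¬ P i)
least P? zero p = zero , p , λ _ ()
least {P} P? (suc n) p with P? zero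
... | yes p₀ = zero , p₀ , λ _ ()
... | no ¬p₀ = let r , pr , below = least (P? ∘ suc) n p in
  suc r , pr , λ { zero _ → ¬p₀ ; (suc i) (s≤s i<r) → below i i<r }

-- `GRProp` speaks of all larger complete graphs, so it is not tested directly. Descending from a
-- known bound `suc G`, only colourings on exactly `G` vertices are in question: an avoiding one
-- makes `suc G` least, and otherwise `G` is a bound too.
grLeast : ∀ {k m} G → GRProp k m G → Σ ℕ λ g → IsGR k m g × g ≤ G
grLeast zero prop = zero , (prop , λ _ ()) , z≤n
grLeast {k} {m} (suc G) prop with avoiding? {G} {k} m
... | yes (c , u , ¬rb , ¬mono) = suc G , (prop , below) , ℕₚ.≤-refl
  where
  below : ∀ i → i < suc G → ¬ GRProp k m i
  below i (s≤s i≤G) gr = [ ¬rb , ¬mono ]′ (gr G i≤G c u)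
... | no none = let g , isGR , g≤G = grLeast G prop′ in g , isGR , ℕₚ.m≤n⇒m≤1+n g≤G
  where
  prop′ : GRProp k m G
  prop′ N G≤N c u with ℕₚ.m≤n⇒m<n∨m≡n G≤N
  ... | inj₁ G<N = prop N G<N c u
  ... | inj₂ refl with hasRainbow? c | hasMono? m c
  ...   | yes rb | _        = inj₁ rb
  ...   | no _   | yes mono = inj₂ mono
  ...   | no ¬rb | no ¬mono = ⊥-elim (none (c , u , ¬rb , ¬mono))

-- Finiteness of the Ramsey number

chainSize : ℕ → ℕ → ℕ
chainSize m zero    = m
chainSize m (suc j) = suc (chainSize m j + chainSize m j)

zero∨one : (y : Fin 2) → y ≡ zero ⊎ y ≡ suc zero
zero∨one zero       = inj₁ refl
zero∨one (suc zero) = inj₂ refl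

module _ (c : Colouring n 2) where

  colourNbr? : ∀ {P : Pred (Fin n) 0ℓ} → Decidable P → ∀ v x →
    Decidable (λ i → P i × i ≢ v × col c v i ≡ x)
  colourNbr? P? v x i = P? i ×-dec ¬? (i ≟ v) ×-dec (col c v i ≟ x)

  halve : ∀ {P : Pred (Fin n) 0ℓ} (P? : Decidable P) s → suc (s + s) ≤ # P? →
          Σ (Fin n) λ v → P v × Σ (Fin 2) λ x → s ≤ # (colourNbr? P? v x)
  halve {P} P? s large = v , proj₂ (proj₂ v∈) zero , big
    where
    v∈ = pick 1 P? (ℕₚ.≤-trans (s≤s z≤n) large)
    v = proj₁ v∈ zero
    cover : # P? ≤ 1 + (# (colourNbr? P? v zero) + # (colourNbr? P? v (suc zero)))
    cover = begin
      # P?  ≤⟨ #-cover P? (_≟ v) (colourNbr? P? v zero ∪? colourNbr? P? v (suc zero)) split ⟩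
      # (_≟ v) + # (colourNbr? P? v zero ∪? colourNbr? P? v (suc zero))
        ≤⟨ ℕₚ.+-mono-≤ (ℕₚ.≤-reflexive (#-≟ v))
                       (#-∪ (colourNbr? P? v zero) (colourNbr? P? v (suc zero))) ⟩
      _ ∎
      where
      open ℕₚ.≤-Reasoning
      split : ∀ {i} → P i → _
      split {i} p with i ≟ v
      ... | yes e = inj₁ e
      ... | no ¬e with zero∨one (col c v i)
      ...   | inj₁ e = inj₂ (inj₁ (p , ¬e , e))
      ...   | inj₂ e = inj₂ (inj₂ (p , ¬e , e))
    big : Σ (Fin 2) λ x → s ≤ # (colourNbr? P? v x)
    big with s ℕₚ.≤? # (colourNbr? P? v zero) | s ℕₚ.≤? # (colourNbr? P? v (suc zero))
    ... | yes h | _     = zero , h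
    ... | no _  | yes h = suc zero , h
    ... | no h₀ | no h₁ = ⊥-elim (ℕₚ.<⇒≱ (ℕₚ.+-mono-< (ℕₚ.≰⇒> h₀) (ℕₚ.≰⇒> h₁))
                                   (ℕₚ.≤-pred (ℕₚ.≤-trans large cover)))

  -- The colours `x i` may vary with `i`: repeated passage to monochromatic neighbourhoods gives
  -- this much before a majority colour is chosen.
  Chain : ℕ → ℕ → Pred (Fin n) 0ℓ → Set
  Chain m j P =
    Σ (Fin j → Fin n) λ a → Σ (Fin j → Fin 2) λ x → Σ (Fin m → Fin n) λ g →
    Injective _≡_ _≡_ a × Injective _≡_ _≡_ g × (∀ i → P (a i)) × (∀ b → P (g b)) ×
    (∀ i b → a i ≢ g b) × (∀ i b → col c (a i) (g b) ≡ x i)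

  prepend : ∀ {m j P} v x₀ → P v → Chain m j (λ i → P i × i ≢ v × col c v i ≡ x₀) →
            Chain m (suc j) P
  prepend {m} {j} {P} v x₀ Pv (a , x , g , ai , gi , Pa , Pg , dis , cols) =
    a′ , x′ , g , ai′ , gi , Pa′ , proj₁ ∘ Pg , dis′ , cols′
    where
    a′ : Fin (suc j) → Fin n
    a′ zero    = v
    a′ (suc i) = a i
    x′ : Fin (suc j) → Fin 2
    x′ zero    = x₀
    x′ (suc i) = x i
    ai′ : Injective _≡_ _≡_ a′
    ai′ {zero}  {zero}  e = refl
    ai′ {zero}  {suc i} e = ⊥-elim (proj₁ (proj₂ (Pa i)) (≡.sym e))
    ai′ {suc i} {zero}  e = ⊥-elim (proj₁ (proj₂ (Pa i)) e)
    ai′ {suc i} {suc l} e = cong suc (ai e)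
    Pa′ : ∀ i → P (a′ i)
    Pa′ zero    = Pv
    Pa′ (suc i) = proj₁ (Pa i)
    dis′ : ∀ i b → a′ i ≢ g b
    dis′ zero    b e = proj₁ (proj₂ (Pg b)) (≡.sym e)
    dis′ (suc i) b   = dis i b
    cols′ : ∀ i b → col c (a′ i) (g b) ≡ x′ i
    cols′ zero    b = proj₂ (proj₂ (Pg b))
    cols′ (suc i) b = cols i b

  -- Each step spends one vertex and keeps one of its two colour classes, so the guaranteed size
  -- halves; accordingly `chainSize m j` is 2^j (m + 1) - 1.
  chain : ∀ m j {P : Pred (Fin n) 0ℓ} (P? : Decidable P) → chainSize m j ≤ # P? → Chain m j P
  chain m zero P? large = let g , gi , h = pick m P? large in
    (λ ()) , (λ ()) , g , (λ { {()} }) , gi , (λ ()) , h , (λ ()) , (λ ())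
  chain m (suc j) {P} P? large =
    let v , Pv , x₀ , size = halve P? (chainSize m j) large
    in prepend {P = P} v x₀ Pv (chain m j (colourNbr? P? v x₀) size)

majority : ∀ s (x : Fin (suc (s + s)) → Fin 2) → ∃ λ y → suc s ≤ # (λ i → x i ≟ y)
majority s x with suc s ℕₚ.≤? # (λ i → x i ≟ zero) | suc s ℕₚ.≤? # (λ i → x i ≟ suc zero)
... | yes h | _     = zero , h
... | no _  | yes h = suc zero , h
... | no h₀ | no h₁ = ⊥-elim (ℕₚ.<⇒≱ ℕₚ.≤-refl (ℕₚ.≤-trans total
        (ℕₚ.+-mono-≤ (ℕₚ.≤-pred (ℕₚ.≰⇒> h₀)) (ℕₚ.≤-pred (ℕₚ.≰⇒> h₁)))))
  where
  total : suc (s + s) ≤ # (λ i → x i ≟ zero) + # (λ i → x i ≟ suc zero)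
  total = ℕₚ.≤-trans
    (ℕₚ.≤-reflexive (≡.sym (#-all univ? (λ _ → tt))))
    (#-cover univ? (λ i → x i ≟ zero) (λ i → x i ≟ suc zero) (λ {i} _ → zero∨one (x i)))

-- Among five vertices that each see a large set in one colour, three use the same colour.
chain⇒mono : ∀ {m} {P : Pred (Fin n) 0ℓ} {c : Colouring n 2} → Chain c m 5 P → HasMonoK3m m c
chain⇒mono (a , x , g , ai , gi , _ , _ , dis , cols) =
  let y , h = majority 2 x
      t , ti , ty = pick 3 (λ i → x i ≟ y) h
  in a ∘ t , g , y , (λ e → ti (ai e)) , gi , (λ i → dis (t i)) , λ i b → trans (cols (t i) b) (ty i)

large⇒ramsey : ∀ {m n} → chainSize m 5 ≤ n → RamseyProp m n
large⇒ramsey {m} {n} large c = chain⇒mono {P = λ _ → ⊤} {c = c}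
  (chain c m 5 univ? (ℕₚ.≤-trans large (ℕₚ.≤-reflexive (≡.sym (#-all {n = n} univ? (λ _ → tt))))))

-- The lower bound

-- A red star with blue complement: the star is covered by one vertex, and its
-- complement has one vertex too few.
m+3<ramsey : ∀ {m r} → 2 ≤ m → RamseyProp m r → m + 3 < r
m+3<ramsey {m} {zero}  2≤m ram with proj₁ (ram record { col = λ () ; sym = λ () }) zero
... | ()
m+3<ramsey {suc (suc m)} {suc r} (s≤s (s≤s z≤n)) ram with ℕₚ.<-≤-connex (suc (suc m) + 3) (suc r)
... | inj₁ lt = lt
... | inj₂ r≤ = ⊥-elim (absurd (ram star))
  where
  starCol : Fin (suc r) → Fin (suc r) → Fin 2
  starCol zero    _       = zero
  starCol (suc _) zero    = zero
  starCol (suc _) (suc _) = suc zero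
  star : Colouring (suc r) 2
  star = record { col = starCol ; sym = λ
    { zero    zero    _ → refl ; zero    (suc _) _ → refl
    ; (suc _) zero    _ → refl ; (suc _) (suc _) _ → refl } }
  red : ∀ i j → starCol i j ≡ zero → i ≡ zero ⊎ j ≡ zero
  red zero    j    e = inj₁ refl
  red (suc i) zero e = inj₂ refl
  blue : ∀ i j → starCol i j ≡ suc zero → i ≢ zero × j ≢ zero
  blue (suc i) (suc j) e = (λ ()) , (λ ())
  absurd : ¬ HasMonoK3m (suc (suc m)) star
  -- The red edges of the path f 1, g 0, f 0, g 1 all contain the centre, so two distinct vertices
  -- would both be the centre.
  absurd (f , g , zero , fi , gi , dis , mono)
    with red _ _ (mono zero zero) | red _ _ (mono (suc zero) zero) | red _ _ (mono zero (suc zero))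
  ... | inj₁ p | inj₁ q | _      = 0≢1+n (fi (trans p (≡.sym q)))
  ... | inj₁ p | inj₂ q | _      = dis _ _ (trans p (≡.sym q))
  ... | inj₂ p | _      | inj₁ q = dis _ _ (trans q (≡.sym p))
  ... | inj₂ p | _      | inj₂ q = 0≢1+n (gi (trans p (≡.sym q)))
  absurd (f , g , suc zero , fi , gi , dis , mono) =
    ℕₚ.<⇒≱ {r} (ℕₚ.≤-trans r≤ (ℕₚ.≤-reflexive (ℕₚ.+-comm (suc (suc m)) 3))) (injective⇒≤ {f = h} h-inj)
    where
    fg : Fin 3 ⊎ Fin (suc (suc m)) → Fin (suc r)
    fg = [ f , g ]′
    nz : ∀ s → zero ≢ fg s
    nz (inj₁ a) e = proj₁ (blue _ _ (mono a zero)) (≡.sym e)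
    nz (inj₂ b) e = proj₂ (blue _ _ (mono zero b)) (≡.sym e)
    fg-inj : ∀ s t → fg s ≡ fg t → s ≡ t
    fg-inj (inj₁ a) (inj₁ b) e = cong inj₁ (fi e)
    fg-inj (inj₁ a) (inj₂ b) e = ⊥-elim (dis a b e)
    fg-inj (inj₂ a) (inj₁ b) e = ⊥-elim (dis b a (≡.sym e))
    fg-inj (inj₂ a) (inj₂ b) e = cong inj₂ (gi e)
    h : Fin (3 + suc (suc m)) → Fin r
    h i = punchOut (nz (splitAt 3 i))
    h-inj : Injective _≡_ _≡_ h
    h-inj {i} {j} e = trans (≡.sym (join-splitAt 3 _ i)) (trans
      (cong (join 3 _) (fg-inj (splitAt 3 i) (splitAt 3 j)
        (punchOut-injective (nz (splitAt 3 i)) (nz (splitAt 3 j)) e)))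
      (join-splitAt 3 _ j))

monochromatic⇒mono : ∀ {m} (c : Colouring n k) x → (∀ i j → i ≢ j → col c i j ≡ x) →
                     3 + m ≤ n → HasMonoK3m m c
monochromatic⇒mono {m = m} c x all-x le =
  (λ a → inject≤ (a ↑ˡ m) le) , (λ b → inject≤ (3 ↑ʳ b) le) , x ,
  (λ e → ↑ˡ-injective m _ _ (inject≤-injective le le _ _ e)) ,
  (λ e → ↑ʳ-injective 3 _ _ (inject≤-injective le le _ _ e)) ,
  dis , λ a b → all-x _ _ (dis a b)
  where
  dis : ∀ a b → inject≤ (a ↑ˡ m) le ≢ inject≤ (3 ↑ʳ b) le
  dis a b e with trans (≡.sym (splitAt-↑ˡ 3 a m))
                  (trans (cong (splitAt 3) (inject≤-injective le le _ _ e)) (splitAt-↑ʳ 3 m b))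
  ... | ()

-- A missing colour would leave every edge in the other one, and 3 + m vertices then contain a copy.
twoColours-used : ∀ {m} (c : Colouring n 2) → 3 + m ≤ n → ¬ HasMonoK3m m c → UsesAllColours c
twoColours-used c le ¬mono x =
  decidable-stable (any? λ i → any? λ j → ¬? (i ≟ j) ×-dec (col c i j ≟ x)) λ none →
    ¬mono (monochromatic⇒mono c (other x)
      (λ i j i≢j → ≢⇒other _ x λ e → none (i , j , i≢j , e)) le)
  where
  other : Fin 2 → Fin 2
  other zero       = suc zero
  other (suc zero) = zero
  ≢⇒other : ∀ y z → y ≢ z → y ≡ other z
  ≢⇒other zero       zero       ne = ⊥-elim (ne refl)
  ≢⇒other zero       (suc zero) ne = refl
  ≢⇒other (suc zero) zero       ne = refl
  ≢⇒other (suc zero) (suc zero) ne = ⊥-elim (ne refl)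

twoRainbow : (c : Colouring n 2) → ¬ HasRainbowTriangle c
twoRainbow c (a , b , d , _ , _ , _ , p , q , s) = no3 _ _ _ p q s
  where
  no3 : (x y z : Fin 2) → x ≢ y → y ≢ z → x ≢ z → ⊥
  no3 zero       zero       z          p q s = p refl
  no3 zero       (suc zero) zero       p q s = s refl
  no3 zero       (suc zero) (suc zero) p q s = q refl
  no3 (suc zero) zero       zero       p q s = q refl
  no3 (suc zero) zero       (suc zero) p q s = s refl
  no3 (suc zero) (suc zero) z          p q s = p refl

-- Two new vertices joined to everything in a new colour: they cover all edges of that colour,
-- whereas K_{3,m} has no vertex cover of size 2.
module _ {m} (3≤m : 3 ≤ m) where

  extend : Σ (Colouring n k) (Avoiding m) → Σ (Colouring (2 + n) (suc k)) (Avoiding m)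
  extend {n} {k} (c , uses , ¬rb , ¬mono) = c⁺ , uses⁺ , ¬rb⁺ , ¬mono⁺
    where
    colᵉ : Fin (2 + n) → Fin (2 + n) → Fin (suc k)
    colᵉ (suc (suc i)) (suc (suc j)) = suc (col c i j)
    colᵉ (suc (suc i)) zero          = zero
    colᵉ (suc (suc i)) (suc zero)    = zero
    colᵉ zero          _             = zero
    colᵉ (suc zero)    _             = zero

    New : Fin (2 + n) → Set
    New v = v ≡ zero ⊎ v ≡ suc zero

    data View : Fin (2 + n) → Set where
      new : ∀ {v} → New v → View v
      old : ∀ i → View (suc (suc i))

    view : ∀ v → View v
    view zero          = new (inj₁ refl)
    view (suc zero)    = new (inj₂ refl)
    view (suc (suc i)) = old i

    newˡ : ∀ {u} v → New u → colᵉ u v ≡ zero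
    newˡ v (inj₁ refl) = refl
    newˡ v (inj₂ refl) = refl

    newʳ : ∀ u {v} → New v → colᵉ u v ≡ zero
    newʳ zero          _           = refl
    newʳ (suc zero)    _           = refl
    newʳ (suc (suc u)) (inj₁ refl) = refl
    newʳ (suc (suc u)) (inj₂ refl) = refl

    c⁺ : Colouring (2 + n) (suc k)
    c⁺ = record { col = colᵉ ; sym = symᵉ }
      where
      symᵉ : ∀ u v → u ≢ v → colᵉ u v ≡ colᵉ v u
      symᵉ u v u≢v with view u | view v
      ... | new p | _     = trans (newˡ v p) (≡.sym (newʳ v p))
      ... | old i | new q = trans (newʳ _ q) (≡.sym (newˡ _ q))
      ... | old i | old j = cong suc (sym c i j λ { refl → u≢v refl })

    uses⁺ : UsesAllColours c⁺
    uses⁺ zero    = zero , suc zero , (λ ()) , refl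
    uses⁺ (suc x) = let i , j , i≢j , e = uses x in
      suc (suc i) , suc (suc j) , (λ e′ → i≢j (suc-injective (suc-injective e′))) , cong suc e

    ¬rb⁺ : ¬ HasRainbowTriangle c⁺
    ¬rb⁺ (a , b , d , a≢b , b≢d , a≢d , p , q , s) with view a | view b | view d
    ... | new h | _     | _     = s (trans (newˡ _ h) (≡.sym (newˡ _ h)))
    ... | _     | new h | _     = p (trans (newʳ _ h) (≡.sym (newˡ _ h)))
    ... | _     | _     | new h = q (trans (newʳ _ h) (≡.sym (newʳ _ h)))
    ... | old a | old b | old d = ¬rb (a , b , d ,
      (λ { refl → a≢b refl }) , (λ { refl → b≢d refl }) , (λ { refl → a≢d refl }) ,
      (λ e → p (cong suc e)) , (λ e → q (cong suc e)) , (λ e → s (cong suc e)))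

    -- Only two vertices are new, so neither side of K_{3,m} fits among them.
    notAllNew : ∀ {j} → 3 ≤ j → (h : Fin j → Fin (2 + n)) → Injective _≡_ _≡_ h → ¬ (∀ i → New (h i))
    notAllNew 3≤j h inj allNew = ℕₚ.<⇒≱ 3≤j (injective⇒≤ {f = λ i → code (allNew i)} code-inj)
      where
      code : ∀ {v} → New v → Fin 2
      code (inj₁ _) = zero
      code (inj₂ _) = suc zero
      code-inj′ : ∀ {u v} (p : New u) (q : New v) → code p ≡ code q → u ≡ v
      code-inj′ (inj₁ refl) (inj₁ refl) _ = refl
      code-inj′ (inj₂ refl) (inj₂ refl) _ = refl
      code-inj : Injective _≡_ _≡_ (λ i → code (allNew i))
      code-inj {x} {y} e = inj (code-inj′ (allNew x) (allNew y) e)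

    new? : ∀ v → Dec (New v)
    new? v = (v ≟ zero) ⊎-dec (v ≟ suc zero)

    zero⇒new : ∀ u v → colᵉ u v ≡ zero → ¬ New u → New v
    zero⇒new u v e ¬new with view u | view v
    ... | new p | _     = ⊥-elim (¬new p)
    ... | old _ | new q = q
    ... | old _ | old _ with e
    ...   | ()

    suc⇒old : ∀ u v {x} → colᵉ u v ≡ suc x →
      ∃ λ i → ∃ λ j → u ≡ suc (suc i) × v ≡ suc (suc j) × col c i j ≡ x
    suc⇒old u v e with view u | view v
    ... | new p | _     = ⊥-elim (0≢1+n (trans (≡.sym (newˡ v p)) e))
    ... | old _ | new q = ⊥-elim (0≢1+n (trans (≡.sym (newʳ _ q)) e))
    ... | old i | old j = i , j , refl , refl , suc-injective e

    ¬mono⁺ : ¬ HasMonoK3m m c⁺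
    -- Every edge of colour `zero` meets a new vertex, so one old vertex on the side of `f` makes
    -- the whole side of `g` new.
    ¬mono⁺ (f , g , zero , fi , gi , dis , mono) with all? (new? ∘ f)
    ... | yes allNew = notAllNew ℕₚ.≤-refl f fi allNew
    ... | no ¬allNew = notAllNew 3≤m g gi λ b →
      decidable-stable (new? (g b)) λ ¬new → ¬allNew λ a →
      decidable-stable (new? (f a)) λ ¬new′ → ¬new (zero⇒new _ _ (mono a b) ¬new′)
    -- In an old colour both ends of every edge are old, so the copy pulls back to `c`.
    ¬mono⁺ (f , g , suc x , fi , gi , dis , mono) = ¬mono
      ( f′ , g′ , x
      , (λ {a} {a′} e → fi (trans (f≡ a) (trans (cong (2 ↑ʳ_) e) (≡.sym (f≡ a′)))))
      , (λ {b} {b′} e → gi (trans (g≡ b) (trans (cong (2 ↑ʳ_) e) (≡.sym (g≡ b′)))))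
      , (λ a b e → dis a b (trans (f≡ a) (trans (cong (2 ↑ʳ_) e) (≡.sym (g≡ b)))))
      , λ a b → suc-injective (trans (≡.sym (≡.cong₂ colᵉ (f≡ a) (g≡ b))) (mono a b)))
      where
      b₀ : Fin m
      b₀ = inject≤ zero 3≤m
      f′ : Fin 3 → Fin n
      f′ a = proj₁ (suc⇒old _ _ (mono a b₀))
      f≡ : ∀ a → f a ≡ suc (suc (f′ a))
      f≡ a = proj₁ (proj₂ (proj₂ (suc⇒old _ _ (mono a b₀))))
      g′ : Fin m → Fin n
      g′ b = proj₁ (proj₂ (suc⇒old _ _ (mono zero b)))
      g≡ : ∀ b → g b ≡ suc (suc (g′ b))
      g≡ b = proj₁ (proj₂ (proj₂ (proj₂ (suc⇒old _ _ (mono zero b)))))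

  extend* : ∀ j → Σ (Colouring n 2) (Avoiding m) →
            Σ (Colouring (j * 2 + n) (2 + j)) (Avoiding m)
  extend* zero    avoiding = avoiding
  extend* (suc j) avoiding = extend (extend* j avoiding)

  -- Minimality of `r` supplies a 2-colouring on r - 1 vertices; `m+3<ramsey` makes it large enough
  -- to use both colours, and `extend*` adds 2j vertices and j colours. `GRProp` at a smaller `g`
  -- would apply to the result.
  lowerBound : ∀ j {r g} → IsRamseyK3m m r → GRProp (2 + j) m g → r + j * 2 ≤ g
  lowerBound j {zero} (ram , _) gr with m+3<ramsey (ℕₚ.≤-trans (ℕₚ.n≤1+n 2) 3≤m) ram
  ... | ()
  lowerBound j {suc r} {g} (ram , min) gr with ℕₚ.<-≤-connex g (suc r + j * 2)
  ... | inj₂ le = le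
  ... | inj₁ lt = ⊥-elim ([ proj₁ (proj₂ avoids) , proj₂ (proj₂ avoids) ]′
                            (gr (j * 2 + r) g≤ c (proj₁ avoids)))
    where
    base : Σ (Colouring r 2) λ c → ¬ HasMonoK3m m c
    base = monoFree (min r ℕₚ.≤-refl)
    3+m≤r : 3 + m ≤ r
    3+m≤r = ℕₚ.≤-trans (ℕₚ.≤-reflexive (ℕₚ.+-comm 3 m))
              (ℕₚ.≤-pred (m+3<ramsey (ℕₚ.≤-trans (ℕₚ.n≤1+n 2) 3≤m) ram))
    ext = extend* j (proj₁ base , twoColours-used (proj₁ base) 3+m≤r (proj₂ base) ,
                     twoRainbow (proj₁ base) , proj₂ base)
    c = proj₁ ext
    avoids = proj₂ ext
    g≤ : g ≤ j * 2 + r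
    g≤ = ℕₚ.≤-trans (ℕₚ.≤-pred lt) (ℕₚ.≤-reflexive (ℕₚ.+-comm r (j * 2)))

-- Gallai's theorem

module _ {R : Rel (Fin n) 0ℓ} (R? : Decidable₂ R) (R-sym : Symmetric R) where

  -- Components are found by merging labels edge by edge: an edge from `a` to `b` moves the class of
  -- `a` to the label of `b`. This makes reachability decidable.
  labelling : ∀ (es : List (Fin n × Fin n)) → Σ (Fin n → Fin n) λ ℓ →
    (∀ {x y} → ℓ x ≡ ℓ y → Star R x y) × (∀ {a b} → (a , b) ∈ es → R a b → ℓ a ≡ ℓ b)
  labelling [] = (λ x → x) , (λ { refl → ε }) , λ ()
  labelling ((a , b) ∷ es) with labelling es | R? a b
  ... | ℓ , sound , complete | no ¬r = ℓ , sound ,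
    λ { (here refl) r → ⊥-elim (¬r r) ; (there e) → complete e }
  ... | ℓ , sound , complete | yes r = ℓ′ , sound′ , complete′
    where
    merge : ∀ i → Dec (i ≡ ℓ a) → Fin n
    merge i (yes _) = ℓ b
    merge i (no _)  = i
    ℓ′ : Fin n → Fin n
    ℓ′ x = merge (ℓ x) (ℓ x ≟ ℓ a)
    ℓ′-cong : ∀ {x y} → ℓ x ≡ ℓ y → ℓ′ x ≡ ℓ′ y
    ℓ′-cong e = cong (λ i → merge i (i ≟ ℓ a)) e
    sound′ : ∀ {x y} → ℓ′ x ≡ ℓ′ y → Star R x y
    sound′ {x} {y} e with ℓ x ≟ ℓ a | ℓ y ≟ ℓ a
    ... | yes p | yes q = sound (trans p (≡.sym q))
    ... | yes p | no _  = sound p ◅◅ (r ◅ sound e)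
    ... | no _  | yes q = sound e ◅◅ (R-sym r ◅ sound (≡.sym q))
    ... | no _  | no _  = sound e
    complete′ : ∀ {x y} → (x , y) ∈ (a , b) ∷ es → R x y → ℓ′ x ≡ ℓ′ y
    complete′ (there e)   r = ℓ′-cong (complete e r)
    complete′ (here refl) r with ℓ a ≟ ℓ a | ℓ b ≟ ℓ a
    ... | yes _ | yes _ = refl
    ... | yes _ | no _  = refl
    ... | no ¬e | _     = ⊥-elim (¬e refl)

  star? : Decidable₂ (Star R)
  star? x y =
    let ℓ , sound , complete = labelling (cartesianProduct (allFin n) (allFin n))
    in map′ sound (close ℓ complete) (ℓ x ≟ ℓ y)
    where
    close : ∀ (ℓ : Fin n → Fin n) →
      (∀ {a b} → (a , b) ∈ cartesianProduct (allFin n) (allFin n) → R a b → ℓ a ≡ ℓ b) →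
      ∀ {a b} → Star R a b → ℓ a ≡ ℓ b
    close ℓ complete ε        = refl
    close ℓ complete (r ◅ rs) =
      trans (complete (∈-cartesianProduct⁺ (∈-allFin _) (∈-allFin _)) r) (close ℓ complete rs)

module Gallai (c : Colouring n (suc (suc k))) (¬rb : ¬ HasRainbowTriangle c) where

  C : Fin n → Fin n → Fin (suc (suc k))
  C = col c

  C-sym : ∀ {x y} → x ≢ y → C x y ≡ C y x
  C-sym = sym c _ _

  triangle : ∀ {a b d} → a ≢ b → b ≢ d → a ≢ d → C a b ≢ C b d →
             C a d ≡ C a b ⊎ C a d ≡ C b d
  triangle {a} {b} {d} a≢b b≢d a≢d ne with C a d ≟ C a b | C a d ≟ C b d
  ... | yes e | _     = inj₁ e
  ... | _     | yes e = inj₂ e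
  ... | no ¬e | no ¬f = ⊥-elim (¬rb (a , b , d , a≢b , b≢d , a≢d , ne , ¬f ∘ ≡.sym , ¬e ∘ ≡.sym))

  OtherEdge : Pred (Fin n) 0ℓ → (p q : Fin (suc (suc k))) → Rel (Fin n) 0ℓ
  OtherEdge W p q x y = W x × W y × x ≢ y × C x y ≢ p × C x y ≢ q

  otherEdge-sym : ∀ {W p q} → Symmetric (OtherEdge W p q)
  otherEdge-sym (Wx , Wy , x≢y , ¬p , ¬q) =
    Wy , Wx , x≢y ∘ ≡.sym , ¬p ∘ trans (C-sym x≢y) , ¬q ∘ trans (C-sym x≢y)

  -- Its classes inside `W` are the blocks of Gallai's partition with `p` and `q` as the colours
  -- between blocks.
  Conn : Pred (Fin n) 0ℓ → (p q : Fin (suc (suc k))) → Rel (Fin n) 0ℓ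
  Conn W p q = Star (OtherEdge W p q)

  module _ {W : Pred (Fin n) 0ℓ} {p q : Fin (suc (suc k))} where

    conn? : Decidable W → Decidable₂ (Conn W p q)
    conn? W? = star? (λ x y → W? x ×-dec W? y ×-dec ¬? (x ≟ y) ×-dec ¬? (C x y ≟ p) ×-dec ¬? (C x y ≟ q))
                     otherEdge-sym

    conn-sym : Symmetric (Conn W p q)
    conn-sym = reverse otherEdge-sym

    apart : ∀ {x y} → ¬ Conn W p q x y → x ≢ y
    apart ¬conn refl = ¬conn ε

    cross : ∀ {x y} → W x → W y → ¬ Conn W p q x y → C x y ≡ p ⊎ C x y ≡ q
    cross {x} {y} Wx Wy ¬conn with C x y ≟ p | C x y ≟ q
    ... | yes e | _     = inj₁ e
    ... | _     | yes e = inj₂ e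
    ... | no ¬p | no ¬q = ⊥-elim (¬conn (return (Wx , Wy , (apart ¬conn) , ¬p , ¬q)))

    -- In the triangle x, x′, y the edge x x′ has neither colour `p` nor `q`, whereas the other two
    -- edges run between components and have one of these colours. As the triangle is not rainbow,
    -- the two agree.
    edge-uniform : ∀ {x x′ y} → OtherEdge W p q x x′ → W y → ¬ Conn W p q x′ y → C x y ≡ C x′ y
    edge-uniform {x} {x′} {y} e@(Wx , Wx′ , x≢x′ , ¬p , ¬q) Wy ¬conn′
      with triangle x≢x′ (apart ¬conn′) (λ { refl → ¬conn′ (return (otherEdge-sym e)) }) ne
      where
      ne : C x x′ ≢ C x′ y
      ne f = [ ¬p ∘ trans f , ¬q ∘ trans f ]′ (cross Wx′ Wy ¬conn′)
    ... | inj₂ f = f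
    ... | inj₁ f = ⊥-elim ([ ¬p ∘ trans (≡.sym f) , ¬q ∘ trans (≡.sym f) ]′
                             (cross Wx Wy λ conn → ¬conn′ (otherEdge-sym e ◅ conn)))

    uniform : ∀ {x x′ y} → Conn W p q x x′ → W y → ¬ Conn W p q x y → C x y ≡ C x′ y
    uniform ε        Wy ¬conn = refl
    uniform (e ◅ es) Wy ¬conn =
      let ¬conn′ = λ conn → ¬conn (e ◅ conn) in
      trans (edge-uniform e Wy ¬conn′) (uniform es Wy ¬conn′)

  -- The conclusion of Gallai's theorem: `x` and `y` certify that the partition has at least two
  -- blocks.
  Split : Pred (Fin n) 0ℓ → Set
  Split W = Σ (Fin (suc (suc k))) λ p → Σ (Fin (suc (suc k))) λ q → p ≢ q ×
    Σ (Fin n) λ x → Σ (Fin n) λ y → W x × W y × ¬ Conn W p q x y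

  split-resp : ∀ {W W′ : Pred (Fin n) 0ℓ} → W ⊆ W′ → W′ ⊆ W → Split W → Split W′
  split-resp f g (p , q , p≢q , x , y , Wx , Wy , ¬conn) =
    p , q , p≢q , x , y , f Wx , f Wy ,
    ¬conn ∘ map⋆ (λ (Wa , Wb , rest) → g Wa , g Wb , rest)

  -- No edge at `v` has a third colour, so `v` is a block by itself.
  isolated⇒split : ∀ {W : Pred (Fin n) 0ℓ} {p q v x} → p ≢ q → W v → W x → v ≢ x →
    (∀ u → W u → v ≢ u → C v u ≡ p ⊎ C v u ≡ q) → Split W
  isolated⇒split {p = p} {q} {v} {x} p≢q Wv Wx v≢x only =
    p , q , p≢q , v , x , Wv , Wx , λ
      { ε → v≢x refl
      ; ((_ , Wu , v≢u , ¬p , ¬q) ◅ _) → [ ¬p , ¬q ]′ (only _ Wu v≢u) }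

  -- If the new vertex v has an other-coloured edge to every component, all those edges share
  -- one colour g; were both p and q also present at v, two vertices joined to v in p and q
  -- would force the colour between components to be p as well as q.
  module AddVertex {W : Pred (Fin n) 0ℓ} (W? : Decidable W) (v : Fin n) (¬Wv : ¬ W v) where

    W⁺ : Pred (Fin n) 0ℓ
    W⁺ x = x ≡ v ⊎ W x

    v≢ : ∀ {x} → W x → v ≢ x
    v≢ Wx refl = ¬Wv Wx

    split⁺ : Split W → Split W⁺
    split⁺ (p , q , p≢q , x₀ , y₀ , Wx₀ , Wy₀ , x₀≁y₀) =
      decide (any? λ x → W? x ×-dec ¬? (touches? x))
      where
      _~_ = Conn W p q

      Touches : Pred (Fin n) 0ℓ
      Touches x = ∃ λ x′ → W x′ × x ~ x′ × C v x′ ≢ p × C v x′ ≢ q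

      touches? : Decidable Touches
      touches? x = any? λ x′ → W? x′ ×-dec conn? W? x x′ ×-dec ¬? (C v x′ ≟ p) ×-dec ¬? (C v x′ ≟ q)

      -- A component that `v` does not touch remains a component of `W⁺`, so the old colours still
      -- separate it from `v`.
      stays : ∀ {x a b} → ¬ Touches x → Conn W⁺ p q a b → W a → x ~ a → W b
      stays ¬t ε Wa x~a = Wa
      stays ¬t ((_ , inj₁ refl , a≢v , ¬p , ¬q) ◅ _) Wa x~a =
        ⊥-elim (¬t (_ , Wa , x~a , ¬p ∘ trans (C-sym a≢v) , ¬q ∘ trans (C-sym a≢v)))
      stays ¬t ((_ , inj₂ Wa′ , rest) ◅ es) Wa x~a =
        stays ¬t es Wa′ (x~a ◅◅ return (Wa , Wa′ , rest))

      module _ (touches : ∀ x → W x → Touches x) where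

        -- The edge x′ u runs between components and has colour `p` or `q`, unlike v x′, so the
        -- triangle v, x′, u leaves two choices.
        viaNbr : ∀ {x′ u} → W x′ → C v x′ ≢ p → C v x′ ≢ q → W u → ¬ x′ ~ u →
                 C v u ≡ C v x′ ⊎ C v u ≡ C x′ u
        viaNbr Wx′ ¬p ¬q Wu x′≁u = triangle (v≢ Wx′) (apart x′≁u) (v≢ Wu) λ e →
          [ ¬p ∘ trans e , ¬q ∘ trans e ]′ (cross Wx′ Wu x′≁u)

        tx = touches x₀ Wx₀
        ty = touches y₀ Wy₀
        g = C v (proj₁ tx)

        g≢p : g ≢ p
        g≢p = proj₁ (proj₂ (proj₂ (proj₂ tx)))

        g≢q : g ≢ q
        g≢q = proj₂ (proj₂ (proj₂ (proj₂ tx)))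

        near : ∀ {u} → W u → ¬ x₀ ~ u → C v u ≡ g ⊎ (C v u ≡ p ⊎ C v u ≡ q)
        near {u} Wu x₀≁u =
          let x′ , Wx′ , x₀~x′ , ¬p , ¬q = tx
              x′≁u = λ conn → x₀≁u (x₀~x′ ◅◅ conn)
          in Sum.map₂ (λ e → Sum.map (trans e) (trans e) (cross Wx′ Wu x′≁u)) (viaNbr Wx′ ¬p ¬q Wu x′≁u)

        colours : ∀ {u} → W u → C v u ≡ g ⊎ (C v u ≡ p ⊎ C v u ≡ q)
        colours {u} Wu with conn? {p = p} {q} W? x₀ u
        ... | no x₀≁u = near Wu x₀≁u
        -- Here the touching neighbour of `y₀` takes over. Its edge to `v` is neither `p` nor `q`,
        -- hence has colour `g` by `near`.
        ... | yes x₀~u =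
          let y′ , Wy′ , y₀~y′ , ¬p , ¬q = ty
              y′≁u = λ conn → x₀≁y₀ (x₀~u ◅◅ conn-sym (y₀~y′ ◅◅ conn))
              y′-g = [ (λ e → e) , (λ pq → ⊥-elim ([ ¬p , ¬q ]′ pq)) ]′
                       (near Wy′ λ conn → x₀≁y₀ (conn ◅◅ conn-sym y₀~y′))
          in Sum.map (λ e → trans e y′-g) (λ e → Sum.map (trans e) (trans e) (cross Wy′ Wu y′≁u))
                     (viaNbr Wy′ ¬p ¬q Wu y′≁u)

        -- The component of `w` contains some w′ with v w′ of a third colour; the triangle v, w′, u
        -- then gives w′ u the colour of v u, and uniformity carries it to `w`.
        forced : ∀ {u w} → C v u ≡ p ⊎ C v u ≡ q → W u → W w → ¬ w ~ u → C w u ≡ C v u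
        forced {u} {w} pq Wu Ww w≁u =
          let w′ , Ww′ , w~w′ , ¬p , ¬q = touches w Ww
              w′≁u = λ conn → w≁u (w~w′ ◅◅ conn)
              Cw′u = [ (λ e → ⊥-elim ([ ¬p ∘ trans (≡.sym e) , ¬q ∘ trans (≡.sym e) ]′ pq)) , (λ e → e) ]′
                       (viaNbr Ww′ ¬p ¬q Wu w′≁u)
          in trans (uniform w~w′ Wu w≁u) (≡.sym Cw′u)

        elsewhere : ∀ u → ∃ λ w → W w × ¬ w ~ u
        elsewhere u with conn? {p = p} {q} W? x₀ u
        ... | no x₀≁u  = x₀ , Wx₀ , x₀≁u
        ... | yes x₀~u = y₀ , Wy₀ , λ conn → x₀≁y₀ (x₀~u ◅◅ conn-sym conn)

        -- If u and u′ lie in different components, `forced` gives the edge u u′ both colours.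
        -- Otherwise a vertex of another component sees both in one colour, which `forced` makes `p`
        -- and `q`.
        notBoth : ∀ {u u′} → W u → W u′ → C v u ≡ p → C v u′ ≢ q
        notBoth {u} {u′} Wu Wu′ e e′ with conn? {p = p} {q} W? u u′
        ... | no u≁u′ = p≢q (trans (≡.sym (trans (forced (inj₁ e) Wu Wu′ (u≁u′ ∘ conn-sym)) e))
                (trans (C-sym (apart u≁u′ ∘ ≡.sym)) (trans (forced (inj₂ e′) Wu′ Wu u≁u′) e′)))
        ... | yes u~u′ =
          let w , Ww , w≁u = elsewhere u
              w≁u′ = λ conn → w≁u (conn ◅◅ conn-sym u~u′)
          in p≢q (trans (≡.sym (trans (forced (inj₁ e) Wu Ww w≁u) e))
                 (trans (C-sym (apart w≁u))
                 (trans (uniform u~u′ Ww (w≁u ∘ conn-sym))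
                 (trans (C-sym (apart w≁u′ ∘ ≡.sym))
                 (trans (forced (inj₂ e′) Wu′ Ww w≁u′) e′)))))

        -- The colours at `v` are among `g`, `p` and `q`, and the last two do not both occur. So `v`
        -- is isolated for `g` and the one that may occur.
        addSplit : Split W⁺
        addSplit with any? (λ u → W? u ×-dec (C v u ≟ p))
        ... | no none = isolated⇒split g≢q (inj₁ refl) (inj₂ Wx₀) (v≢ Wx₀) λ
          { u (inj₁ refl) v≢v → ⊥-elim (v≢v refl)
          ; u (inj₂ Wu) _ → [ inj₁ , [ (λ e → ⊥-elim (none (u , Wu , e))) , inj₂ ]′ ]′ (colours Wu) }
        ... | yes (u₀ , Wu₀ , e₀) = isolated⇒split g≢p (inj₁ refl) (inj₂ Wx₀) (v≢ Wx₀) λ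
          { u (inj₁ refl) v≢v → ⊥-elim (v≢v refl)
          ; u (inj₂ Wu) _ → [ inj₁ , [ inj₂ , (λ e → ⊥-elim (notBoth Wu₀ Wu e₀ e)) ]′ ]′ (colours Wu) }

      decide : Dec (∃ λ x → W x × ¬ Touches x) → Split W⁺
      decide (yes (x , Wx , ¬t)) =
        p , q , p≢q , x , v , inj₂ Wx , inj₁ refl , λ conn → ¬Wv (stays ¬t conn Wx ε)
      decide (no none) = addSplit λ x Wx →
        decidable-stable (touches? x) λ ¬t → none (x , Wx , ¬t)

  otherColour : ∀ (p : Fin (suc (suc k))) → ∃ λ q → p ≢ q
  otherColour zero    = suc zero , λ ()
  otherColour (suc _) = zero , λ ()

  -- Gallai's theorem by adding vertices one at a time; the first alternative is a list with at most
  -- one distinct element.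
  splitList : ∀ S → (∀ {x y} → x ∈ S → y ∈ S → x ≡ y) ⊎ Split (_∈ S)
  splitList [] = inj₁ λ ()
  splitList (v ∷ S) with member? _≟_ v S | splitList S
  ... | yes v∈S | inj₂ sp = inj₂ (split-resp there (λ { (here refl) → v∈S ; (there e) → e }) sp)
  ... | yes v∈S | inj₁ same = inj₁ λ x∈ y∈ → same (drop x∈) (drop y∈)
    where
    drop : ∀ {x} → x ∈ v ∷ S → x ∈ S
    drop (here refl) = v∈S
    drop (there e)   = e
  ... | no v∉S | inj₂ sp = inj₂ (split-resp
    (λ { (inj₁ refl) → here refl ; (inj₂ e) → there e })
    (λ { (here e) → inj₁ e ; (there e) → inj₂ e })
    (AddVertex.split⁺ (λ x → member? _≟_ x S) v v∉S sp))
  splitList (v ∷ []) | no _ | inj₁ _ = inj₁ λ { (here refl) (here refl) → refl }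
  -- All old elements equal `u`, so `v` sees one colour and any second colour completes the pair.
  splitList (v ∷ u ∷ S) | no v∉ | inj₁ same = inj₂ (isolated⇒split (proj₂ (otherColour (C v u)))
    (here refl) (there (here refl)) (λ { refl → v∉ (here refl) }) λ
      { w (here refl) v≢v → ⊥-elim (v≢v refl)
      ; w (there e) _ → inj₁ (cong (C v) (same e (here refl))) })

  gallai : ∀ {W : Pred (Fin n) 0ℓ} → Decidable W → ∀ {x y} → W x → W y → x ≢ y → Split W
  gallai {W} W? {x} {y} Wx Wy x≢y with splitList (filter W? (allFin n))
  ... | inj₁ same = ⊥-elim (x≢y (same (∈-filter⁺ W? (∈-allFin x) Wx) (∈-filter⁺ W? (∈-allFin y) Wy)))
  ... | inj₂ sp = split-resp (λ e → proj₂ (∈-filter⁻ W? {xs = allFin n} e)) (∈-filter⁺ W? (∈-allFin _)) sp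

-- The upper bound

-- Closes the numerical contradictions: `d` is the explicit slack, which leaves a polynomial
-- identity.
overflow : ∀ {a b} d → a ≡ suc (b + d) → a ≤ b → ⊥
overflow {b = b} d refl le = ℕₚ.<⇒≱ (s≤s (ℕₚ.m≤m+n b d)) le

#-singleton≤1 : (i : Fin n) → # (_≟ i) ≤ 1
#-singleton≤1 i = ℕₚ.≤-reflexive (#-≟ i)

#-fibres : {P : Pred (Fin n) 0ℓ} (P? : Decidable P) (f : Fin n → Fin k) →
           # P? ≤ sum (λ x → # (λ v → P? v ×-dec (f v ≟ x)))
#-fibres P? f = ℕₚ.≤-trans
  (sum-mono-≤ λ v → ⟦⟧≤ (P? v) λ p → ℕₚ.≤-trans
    (ℕₚ.≤-reflexive (≡.sym (⟦⟧-yes (P? v ×-dec (f v ≟ f v)) (p , refl))))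
    (term≤sum (λ x → ⟦ P? v ×-dec (f v ≟ x) ⟧) (f v)))
  (ℕₚ.≤-reflexive (∑-comm λ v x → ⟦ P? v ×-dec (f v ≟ x) ⟧))

sum-supported : {P : Pred (Fin n) 0ℓ} (P? : Decidable P) (S : Fin n → ℕ) {D : ℕ} →
                (∀ y → P y → S y ≤ D) → (∀ y → ¬ P y → S y ≡ 0) → sum S ≤ # P? * D
sum-supported P? S {D} on off = ℕₚ.≤-trans (sum-mono-≤ pointwise)
  (ℕₚ.≤-reflexive (≡.sym (*-distribʳ-sum D (λ i → ⟦ P? i ⟧))))
  where
  pointwise : ∀ y → S y ≤ ⟦ P? y ⟧ * D
  pointwise y with P? y
  ... | yes p = ℕₚ.≤-trans (on y p) (ℕₚ.≤-reflexive (≡.sym (ℕₚ.+-identityʳ D)))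
  ... | no ¬p = ℕₚ.≤-reflexive (off y ¬p)

-- Pairs of the first kind are counted at their end in `Q`, those of the second kind at their end in
-- `P`.
doubleCount : {P Q : Pred (Fin n) 0ℓ} {E F : Rel (Fin n) 0ℓ} {D : ℕ}
  (P? : Decidable P) (Q? : Decidable Q) (E? : Decidable₂ E) (F? : Decidable₂ F) →
  (∀ {y z} → P y → Q z → E z y ⊎ F y z) →
  (∀ z → Q z → # (λ y → P? y ×-dec E? z y) ≤ D) →
  (∀ y → P y → # (λ z → Q? z ×-dec F? y z) ≤ D) →
  # P? * # Q? ≤ # Q? * D + # P? * D
doubleCount {P = P} {Q} {E} {F} {D} P? Q? E? F? cover degE degF = begin
  # P? * # Q?                               ≡⟨ *-distribʳ-sum (# Q?) (λ y → ⟦ P? y ⟧) ⟩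
  sum (λ y → ⟦ P? y ⟧ * # Q?)               ≤⟨ sum-mono-≤ pointwise ⟩
  sum (λ y → # (e? y) + # (f? y))           ≡⟨ ∑-distrib-+ (λ y → # (e? y)) (λ y → # (f? y)) ⟩
  sum (λ y → # (e? y)) + sum (λ y → # (f? y))
    ≡⟨ cong (_+ sum (λ y → # (f? y))) (∑-comm λ y z → ⟦ e? y z ⟧) ⟩
  sum (λ z → # (λ y → e? y z)) + sum (λ y → # (f? y))
    ≤⟨ ℕₚ.+-mono-≤
         (sum-supported Q? (λ z → # (λ y → e? y z))
           (λ z Qz → ℕₚ.≤-trans
             (#-mono (λ y → e? y z) (λ y → P? y ×-dec E? z y) (λ (Py , _ , Ezy) → Py , Ezy)) (degE z Qz))
           (λ z ¬Qz → #-none (λ y → e? y z) λ y h → ¬Qz (proj₁ (proj₂ h))))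
         (sum-supported P? (λ y → # (f? y))
           (λ y Py → ℕₚ.≤-trans
             (#-mono (f? y) (λ z → Q? z ×-dec F? y z) proj₂) (degF y Py))
           (λ y ¬Py → #-none (f? y) λ z h → ¬Py (proj₁ h))) ⟩
  # Q? * D + # P? * D ∎
  where
  open ℕₚ.≤-Reasoning
  e? : ∀ y → Decidable (λ z → P y × Q z × E z y)
  e? y z = P? y ×-dec Q? z ×-dec E? z y
  f? : ∀ y → Decidable (λ z → P y × Q z × F y z)
  f? y z = P? y ×-dec Q? z ×-dec F? y z
  pointwise : ∀ y → ⟦ P? y ⟧ * # Q? ≤ # (e? y) + # (f? y)
  pointwise y = helper (P? y)
    where
    helper : (d : Dec (P y)) → ⟦ d ⟧ * # Q? ≤ # (e? y) + # (f? y)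
    helper (no _)   = z≤n
    helper (yes Py) = ℕₚ.≤-trans (ℕₚ.≤-reflexive (ℕₚ.+-identityʳ (# Q?)))
      (#-cover Q? (e? y) (f? y) λ Qz → Sum.map (λ Ezy → Py , Qz , Ezy) (λ Fyz → Py , Qz , Fyz) (cover Py Qz))

-- (A − a)(A − b) ≥ 0 for A = 11 + 4μ, written without subtraction.
rectangle : ∀ μ {a b} → a ≤ 11 + 4 * μ → b ≤ 11 + 4 * μ → 14 + 6 * μ ≤ a + b →
            a * b ≤ b * (2 + μ) + a * (2 + μ) → ⊥
rectangle μ {a} {b} a≤ b≤ s≤ ab≤ =
  overflow (4 + 8 * μ + 2 * (μ * μ)) (identity μ) (ℕₚ.≤-trans (ℕₚ.*-monoʳ-≤ (9 + 3 * μ) s≤) bound)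
  where
  A = 11 + 4 * μ
  α = proj₁ (ℕₚ.m≤n⇒∃[o]m+o≡n a≤)
  β = proj₁ (ℕₚ.m≤n⇒∃[o]m+o≡n b≤)
  a+α : a + α ≡ A
  a+α = proj₂ (ℕₚ.m≤n⇒∃[o]m+o≡n a≤)
  b+β : b + β ≡ A
  b+β = proj₂ (ℕₚ.m≤n⇒∃[o]m+o≡n b≤)
  identity : ∀ μ → (9 + 3 * μ) * (14 + 6 * μ) ≡
                   suc ((11 + 4 * μ) * (11 + 4 * μ) + (4 + 8 * μ + 2 * (μ * μ)))
  identity = solve-∀
  expand : ∀ a b α β → (a + α) * (b + β) + a * b ≡ (b + β) * a + (a + α) * b + α * β
  expand = solve-∀
  split : ∀ a b μ → (11 + 4 * μ) * a + (11 + 4 * μ) * b ≡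
                    (9 + 3 * μ) * (a + b) + (b * (2 + μ) + a * (2 + μ))
  split = solve-∀
  -- Expanding the product gives A(a + b) ≤ A² + ab. The bound on ab then leaves the factor A - (2 +
  -- μ) = 9 + 3μ.
  bound : (9 + 3 * μ) * (a + b) ≤ A * A
  bound = ℕₚ.+-cancelʳ-≤ (b * (2 + μ) + a * (2 + μ)) _ _ (begin
    (9 + 3 * μ) * (a + b) + (b * (2 + μ) + a * (2 + μ)) ≡⟨ split a b μ ⟨
    A * a + A * b                                       ≡⟨ cong₂ (λ s t → s * a + t * b) b+β a+α ⟨
    (b + β) * a + (a + α) * b                           ≤⟨ ℕₚ.m≤m+n _ (α * β) ⟩
    (b + β) * a + (a + α) * b + α * β                   ≡⟨ expand a b α β ⟨
    (a + α) * (b + β) + a * b                           ≡⟨ cong₂ (λ s t → s * t + a * b) a+α b+β ⟩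
    A * A + a * b                                       ≤⟨ ℕₚ.+-monoʳ-≤ (A * A) ab≤ ⟩
    A * A + (b * (2 + μ) + a * (2 + μ))                 ∎)
    where open ℕₚ.≤-Reasoning

-- Raising `f` by 2 at `p` and at `q` keeps all values at most 2, so the sum is at most 2(2 + k) -
-- 4.
sum-two-vanish : ∀ {p q : Fin (2 + k)} → p ≢ q → (f : Fin (2 + k) → ℕ) →
                 f p ≡ 0 → f q ≡ 0 → (∀ x → f x ≤ 2) → sum f ≤ k * 2
sum-two-vanish {k} {p} {q} p≢q f fp fq f≤ = ℕₚ.+-cancelʳ-≤ 4 _ _ (begin
  sum f + 4                                     ≡⟨ cong₂ (λ s t → sum f + (s * 2 + t * 2)) (#-≟ p) (#-≟ q) ⟨
  sum f + (# (_≟ p) * 2 + # (_≟ q) * 2)         ≡⟨ cong (sum f +_) (cong₂ _+_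
                                                      (*-distribʳ-sum 2 (λ x → ⟦ x ≟ p ⟧))
                                                      (*-distribʳ-sum 2 (λ x → ⟦ x ≟ q ⟧))) ⟩
  sum f + (sum (λ x → ⟦ x ≟ p ⟧ * 2) + sum (λ x → ⟦ x ≟ q ⟧ * 2))
    ≡⟨ cong (sum f +_) (∑-distrib-+ (λ x → ⟦ x ≟ p ⟧ * 2) (λ x → ⟦ x ≟ q ⟧ * 2)) ⟨
  sum f + sum (λ x → ⟦ x ≟ p ⟧ * 2 + ⟦ x ≟ q ⟧ * 2)
    ≡⟨ ∑-distrib-+ f (λ x → ⟦ x ≟ p ⟧ * 2 + ⟦ x ≟ q ⟧ * 2) ⟨
  sum (λ x → f x + (⟦ x ≟ p ⟧ * 2 + ⟦ x ≟ q ⟧ * 2)) ≤⟨ sum-mono-≤ pointwise ⟩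
  sum {2 + k} (λ _ → 2)                         ≡⟨ sum-const (2 + k) 2 ⟩
  4 + k * 2                                     ≡⟨ ℕₚ.+-comm 4 (k * 2) ⟩
  k * 2 + 4                                     ∎)
  where
  open ℕₚ.≤-Reasoning
  pointwise : ∀ x → f x + (⟦ x ≟ p ⟧ * 2 + ⟦ x ≟ q ⟧ * 2) ≤ 2
  pointwise x with x ≟ p | x ≟ q
  ... | yes refl | yes e    = ⊥-elim (p≢q e)
  ... | yes refl | no _     rewrite fp = ℕₚ.≤-refl
  ... | no _     | yes refl rewrite fq = ℕₚ.≤-refl
  ... | no _     | no _     = ℕₚ.≤-trans (ℕₚ.≤-reflexive (ℕₚ.+-identityʳ (f x))) (f≤ x)

≰⇒≤ : ∀ {s t} → ¬ suc s ≤ t → t ≤ s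
≰⇒≤ h = ℕₚ.≤-pred (ℕₚ.≰⇒> h)

-- Colourings with k = 2 + κ and m = 3 + μ that avoid both structures

module Upper {N κ μ r : ℕ} (c : Colouring N (2 + κ)) (¬rb : ¬ HasRainbowTriangle c)
             (¬mono : ¬ HasMonoK3m (3 + μ) c) (ramsey : RamseyProp (3 + μ) r) where

  open Gallai c ¬rb

  infixr 5 _⊕_
  _⊕_ : ∀ {P Q : Pred (Fin N) 0ℓ} {P? : Decidable P} {Q? : Decidable Q} {a b} →
        # P? ≤ a → # Q? ≤ b → # (P? ∪? Q?) ≤ a + b
  _⊕_ {P? = P?} {Q?} h h′ = ℕₚ.≤-trans (#-∪ P? Q?) (ℕₚ.+-mono-≤ h h′)

  Joined : Fin (2 + κ) → Rel (Fin N) 0ℓ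
  Joined x a v = a ≢ v × C a v ≡ x

  joined? : ∀ x → Decidable₂ (Joined x)
  joined? x a v = ¬? (a ≟ v) ×-dec (C a v ≟ x)

  -- The form in which the absence of K_{3,m} is used: 3 + μ common neighbours in colour `x` would
  -- complete a copy with `a`, `b`, `d`.
  forbid : ∀ {P : Pred (Fin N) 0ℓ} (P? : Decidable P) {a b d x} → a ≢ b → b ≢ d → a ≢ d →
           (∀ {v} → P v → Joined x a v × Joined x b v × Joined x d v) → # P? ≤ 2 + μ
  forbid {P} P? {a} {b} {d} {x} a≢b b≢d a≢d joined = ≰⇒≤ λ large →
    let g , gi , Pg = pick (3 + μ) P? large
    in ¬mono (f , g , x , fi , gi , (λ i j → proj₁ (at i (Pg j))) , λ i j → proj₂ (at i (Pg j)))
    where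
    f : Fin 3 → Fin N
    f = lookup (a ∷ b ∷ d ∷ [])
    fi : Injective _≡_ _≡_ f
    fi {zero}           {zero}           e = refl
    fi {zero}           {suc zero}       e = ⊥-elim (a≢b e)
    fi {zero}           {suc (suc zero)} e = ⊥-elim (a≢d e)
    fi {suc zero}       {zero}           e = ⊥-elim (a≢b (≡.sym e))
    fi {suc zero}       {suc zero}       e = refl
    fi {suc zero}       {suc (suc zero)} e = ⊥-elim (b≢d e)
    fi {suc (suc zero)} {zero}           e = ⊥-elim (a≢d (≡.sym e))
    fi {suc (suc zero)} {suc zero}       e = ⊥-elim (b≢d (≡.sym e))
    fi {suc (suc zero)} {suc (suc zero)} e = refl
    at : ∀ i {v} → P v → Joined x (f i) v
    at zero             Pv = proj₁ (joined Pv)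
    at (suc zero)       Pv = proj₁ (proj₂ (joined Pv))
    at (suc (suc zero)) Pv = proj₂ (proj₂ (joined Pv))

  pick2 : ∀ {P : Pred (Fin N) 0ℓ} (P? : Decidable P) → 2 ≤ # P? →
          Σ (Fin N) λ a → Σ (Fin N) λ b → P a × P b × a ≢ b
  pick2 P? large = let g , gi , Pg = pick 2 P? large in
    g zero , g (suc zero) , Pg zero , Pg (suc zero) , λ e → 0≢1+n (gi e)

  pick3 : ∀ {P : Pred (Fin N) 0ℓ} (P? : Decidable P) → 3 ≤ # P? →
          Σ (Fin N) λ a → Σ (Fin N) λ b → Σ (Fin N) λ d →
          P a × P b × P d × a ≢ b × b ≢ d × a ≢ d
  pick3 P? large = let g , gi , Pg = pick 3 P? large in
    g zero , g (suc zero) , g (suc (suc zero)) , Pg zero , Pg (suc zero) , Pg (suc (suc zero)) ,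
    (λ e → 0≢1+n (gi e)) , (λ e → ne (gi e)) , (λ e → 0≢1+n (gi e))
    where
    ne : suc zero ≢ suc {2} (suc zero)
    ne ()

  -- The features of Gallai's partition that the counting uses, abstracted so that they serve both
  -- `W` and its enlargement by outside vertices.
  record Blocks (U : Pred (Fin N) 0ℓ) (p q : Fin (2 + κ)) : Set₁ where
    field
      U?      : Decidable U
      p≢q     : p ≢ q
      _~_     : Rel (Fin N) 0ℓ
      _~?_    : Decidable₂ _~_
      ~-refl  : Reflexive _~_
      ~-sym   : Symmetric _~_
      between : ∀ {x y} → U x → U y → ¬ x ~ y → C x y ≡ p ⊎ C x y ≡ q
      same    : ∀ {x x′ y} → x ~ x′ → U y → ¬ x ~ y → C x y ≡ C x′ y

    class? : ∀ x → Decidable (λ y → U y × x ~ y)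
    class? x y = U? y ×-dec (x ~? y)

    field
      small : ∀ {x} → U x → # (class? x) ≤ 2

  swap : ∀ {U p q} → Blocks U p q → Blocks U q p
  swap B = record
    { U? = U? ; p≢q = p≢q ∘ ≡.sym ; _~_ = _~_ ; _~?_ = _~?_
    ; ~-refl = ~-refl ; ~-sym = ~-sym
    ; between = λ Ux Uy x≁y → Sum.swap (between Ux Uy x≁y)
    ; same = same ; small = small }
    where open Blocks B

  -- Three vertices of Z chosen inside at most two classes, or in three singleton classes,
  -- have at least 3 + μ common q-neighbours.
  sparse : ∀ {U Z : Pred (Fin N) 0ℓ} {p q} → Blocks U p q → (Z? : Decidable Z) → Z ⊆ U →
           (∀ {x} → Z x → # (λ z → Z? z ×-dec joined? p x z) ≤ 2 + μ) → 12 + 4 * μ ≤ # Z? → ⊥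
  sparse {U} {Z} {p} {q} B Z? Z⊆U deg large =
    decide (any? λ x → any? λ x′ → Z? x ×-dec Z? x′ ×-dec ¬? (x ≟ x′) ×-dec (x ~? x′))
    where
    open Blocks B
    qJoined : ∀ {x v} → Z x → Z v → ¬ x ~ v → ¬ Joined p x v → Joined q x v
    qJoined Zx Zv x≁v ¬j = ne , [ (λ e → ⊥-elim (¬j (ne , e))) , id ]′ (between (Z⊆U Zx) (Z⊆U Zv) x≁v)
      where
      ne : _ ≢ _
      ne refl = x≁v ~-refl

    decide : Dec (∃ λ x → ∃ λ x′ → Z x × Z x′ × x ≢ x′ × x ~ x′) → ⊥
    -- Away from their class x and x′ see the same colours. Two classes, the `p`-neighbours of x and
    -- y and the common `q`-neighbours cover `Z`, giving at most 10 + 3μ vertices.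
    decide (yes (x , x′ , Zx , Zx′ , x≢x′ , x~x′)) with outside Z? (class? x)
      (ℕₚ.≤-trans (s≤s (small (Z⊆U Zx))) (ℕₚ.≤-trans (ℕₚ.m≤m+n 3 (9 + 4 * μ)) large))
    ... | y , Zy , y∉ = overflow (1 + μ) (count μ) (ℕₚ.≤-trans large
        (ℕₚ.≤-trans (#-mono Z? (class? x ∪? class? y ∪? dp x ∪? dp y ∪? q?) cover)
          (small (Z⊆U Zx) ⊕ small (Z⊆U Zy) ⊕ deg Zx ⊕ deg Zy ⊕ common)))
      where
      x≁y : ¬ x ~ y
      x≁y x~y = y∉ (Z⊆U Zy , x~y)
      dp : ∀ x → Decidable (λ z → Z z × Joined p x z)
      dp x z = Z? z ×-dec joined? p x z
      q? : Decidable (λ v → Z v × ¬ x ~ v × Joined q x v × Joined q y v)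
      q? v = Z? v ×-dec ¬? (x ~? v) ×-dec joined? q x v ×-dec joined? q y v
      common : # q? ≤ 2 + μ
      common = forbid q? x≢x′ (λ { refl → x≁y x~x′ }) (λ { refl → x≁y ~-refl })
        λ (Zv , x≁v , (x≢v , e) , jy) → (x≢v , e) ,
          ((λ { refl → x≁v x~x′ }) , trans (≡.sym (same x~x′ (Z⊆U Zv) x≁v)) e) , jy
      cover : ∀ {v} → Z v → _
      cover {v} Zv with x ~? v | y ~? v | joined? p x v | joined? p y v
      ... | yes h | _ | _ | _ = inj₁ (Z⊆U Zv , h)
      ... | _ | yes h | _ | _ = inj₂ (inj₁ (Z⊆U Zv , h))
      ... | _ | _ | yes h | _ = inj₂ (inj₂ (inj₁ (Zv , h)))
      ... | _ | _ | _ | yes h = inj₂ (inj₂ (inj₂ (inj₁ (Zv , h))))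
      ... | no x≁v | no y≁v | no ¬jx | no ¬jy = inj₂ (inj₂ (inj₂ (inj₂
              (Zv , x≁v , qJoined Zx Zv x≁v ¬jx , qJoined Zy Zv y≁v ¬jy))))
      count : ∀ μ → 12 + 4 * μ ≡ suc (2 + (2 + ((2 + μ) + ((2 + μ) + (2 + μ)))) + (1 + μ))
      count = solve-∀
    -- This case needs the constant in full: three vertices, their `p`-neighbourhoods and the common
    -- `q`-neighbours make up at most 11 + 4μ.
    decide (no none) with pick3 Z? (ℕₚ.≤-trans (ℕₚ.m≤m+n 3 (9 + 4 * μ)) large)
    ... | a , b , d , Za , Zb , Zd , a≢b , b≢d , a≢d = overflow 0 (count μ) (ℕₚ.≤-trans large
        (ℕₚ.≤-trans (#-mono Z? ((_≟ a) ∪? (_≟ b) ∪? (_≟ d) ∪? dp a ∪? dp b ∪? dp d ∪? q?) cover)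
          (#-singleton≤1 a ⊕ #-singleton≤1 b ⊕ #-singleton≤1 d ⊕ deg Za ⊕ deg Zb ⊕ deg Zd ⊕ common)))
      where
      dp : ∀ x → Decidable (λ z → Z z × Joined p x z)
      dp x z = Z? z ×-dec joined? p x z
      q? : Decidable (λ v → Joined q a v × Joined q b v × Joined q d v)
      q? v = joined? q a v ×-dec joined? q b v ×-dec joined? q d v
      common : # q? ≤ 2 + μ
      common = forbid q? a≢b b≢d a≢d id
      q-or-p : ∀ {x v} → Z x → Z v → v ≢ x → ¬ Joined p x v → Joined q x v
      q-or-p Zx Zv v≢x = qJoined Zx Zv λ x~v → none (_ , _ , Zx , Zv , v≢x ∘ ≡.sym , x~v)
      cover : ∀ {v} → Z v → _
      cover {v} Zv with v ≟ a | v ≟ b | v ≟ d | joined? p a v | joined? p b v | joined? p d v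
      ... | yes h | _ | _ | _ | _ | _ = inj₁ h
      ... | _ | yes h | _ | _ | _ | _ = inj₂ (inj₁ h)
      ... | _ | _ | yes h | _ | _ | _ = inj₂ (inj₂ (inj₁ h))
      ... | _ | _ | _ | yes h | _ | _ = inj₂ (inj₂ (inj₂ (inj₁ (Zv , h))))
      ... | _ | _ | _ | _ | yes h | _ = inj₂ (inj₂ (inj₂ (inj₂ (inj₁ (Zv , h)))))
      ... | _ | _ | _ | _ | _ | yes h = inj₂ (inj₂ (inj₂ (inj₂ (inj₂ (inj₁ (Zv , h))))))
      ... | no va | no vb | no vd | no ¬a | no ¬b | no ¬d = inj₂ (inj₂ (inj₂ (inj₂ (inj₂ (inj₂
              (q-or-p Za Zv va ¬a , q-or-p Zb Zv vb ¬b , q-or-p Zd Zv vd ¬d))))))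
      count : ∀ μ → 12 + 4 * μ ≡
        suc (1 + (1 + (1 + ((2 + μ) + ((2 + μ) + ((2 + μ) + (2 + μ)))))) + 0)
      count = solve-∀

  -- Reading `p` and `q` as the two colours gives a colouring of K_r, whose monochromatic copy pulls
  -- back to `c`.
  twoColoured : ∀ {U : Pred (Fin N) 0ℓ} (U? : Decidable U) {p q} →
    (∀ {x y} → U x → U y → x ≢ y → C x y ≡ p ⊎ C x y ≡ q) → ¬ r ≤ # U?
  twoColoured U? {p} {q} pq large =
    let g , gi , Ug = pick r U? large
        f₁ , f₂ , y , f₁i , f₂i , dis , mono = ramsey (restrict g gi)
    in ¬mono (g ∘ f₁ , g ∘ f₂ , decode y , (λ e → f₁i (gi e)) , (λ e → f₂i (gi e)) ,
              (λ a b e → dis a b (gi e)) ,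
              λ a b → decoded _ (pq (Ug _) (Ug _) (λ e → dis a b (gi e))) (mono a b))
    where
    encode : ∀ {x} → Dec (x ≡ p) → Fin 2
    encode (yes _) = zero
    encode (no _)  = suc zero
    decode : Fin 2 → Fin (2 + κ)
    decode zero    = p
    decode (suc _) = q
    decoded : ∀ x {y} → x ≡ p ⊎ x ≡ q → encode (x ≟ p) ≡ y → x ≡ decode y
    decoded x pq eq with x ≟ p | eq
    ... | yes e | refl = e
    ... | no ¬e | refl = [ (λ e → ⊥-elim (¬e e)) , id ]′ pq
    restrict : (g : Fin r → Fin N) → Injective _≡_ _≡_ g → Colouring r 2
    restrict g gi = record
      { col = λ i j → encode (C (g i) (g j) ≟ p)
      ; sym = λ i j i≢j → cong (λ x → encode (x ≟ p)) (C-sym (λ e → i≢j (gi e))) }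

  noBlocks : ∀ {U p q} (B : Blocks U p q) → 16 + 6 * μ ≤ # (Blocks.U? B) → r ≤ # (Blocks.U? B) → ⊥
  noBlocks {U} {p} {q} B large r≤ =
    decide (any? λ x → any? λ x′ → U? x ×-dec U? x′ ×-dec ¬? (x ≟ x′) ×-dec (x ~? x′))
    where
    open Blocks B
    decide : Dec (∃ λ x → ∃ λ x′ → U x × U x′ × x ≢ x′ × x ~ x′) → ⊥
    decide (no none) = twoColoured U?
      (λ Ux Uy x≢y → between Ux Uy λ x~y → none (_ , _ , Ux , Uy , x≢y , x~y)) r≤
    decide (yes (x , x′ , Ux , Ux′ , x≢x′ , x~x′)) =
      finish (12 + 4 * μ ≤? # (nbr? p)) (12 + 4 * μ ≤? # (nbr? q))
      where
      Nbr : Fin (2 + κ) → Pred (Fin N) 0ℓ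
      Nbr t v = U v × ¬ x ~ v × C x v ≡ t
      nbr? : ∀ t → Decidable (Nbr t)
      nbr? t v = U? v ×-dec ¬? (x ~? v) ×-dec (C x v ≟ t)
      -- Neighbours of x in colour t outside its class are also neighbours of x′, so those joined to
      -- z are common to three vertices.
      degree : ∀ t {z} → ¬ x ~ z → # (λ v → nbr? t v ×-dec joined? t z v) ≤ 2 + μ
      degree t {z} x≁z = forbid (λ v → nbr? t v ×-dec joined? t z v)
        x≢x′ (λ { refl → x≁z x~x′ }) (λ { refl → x≁z ~-refl })
        λ ((Uv , x≁v , e) , j) →
          ((λ { refl → x≁v ~-refl }) , e) ,
          ((λ { refl → x≁v x~x′ }) , trans (≡.sym (same x~x′ Uv x≁v)) e) , j
      total : 14 + 6 * μ ≤ # (nbr? p) + # (nbr? q)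
      total = ℕₚ.+-cancelˡ-≤ 2 _ _ (ℕₚ.≤-trans large
        (ℕₚ.≤-trans (#-mono U? (class? x ∪? nbr? p ∪? nbr? q) cover)
                    (small Ux ⊕ #-∪ (nbr? p) (nbr? q))))
        where
        cover : ∀ {v} → U v → _
        cover {v} Uv with x ~? v
        ... | yes h  = inj₁ (Uv , h)
        ... | no x≁v = inj₂ (Sum.map (λ e → Uv , x≁v , e) (λ e → Uv , x≁v , e) (between Ux Uv x≁v))
      -- Each vertex of one neighbourhood has at most 2 + μ edges into the other in that other's
      -- colour, and every edge between them has colour `p` or `q`.
      edges : # (nbr? p) * # (nbr? q) ≤ # (nbr? q) * (2 + μ) + # (nbr? p) * (2 + μ)
      edges = doubleCount (nbr? p) (nbr? q) (joined? p) (joined? q) coloured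
        (λ z (_ , x≁z , _) → degree p x≁z) (λ y (_ , x≁y , _) → degree q x≁y)
        where
        coloured : ∀ {y z} → Nbr p y → Nbr q z → Joined p z y ⊎ Joined q y z
        coloured {y} {z} (Uy , x≁y , ey) (Uz , x≁z , ez) =
          Sum.map (λ e → y≢z ∘ ≡.sym , trans (C-sym (y≢z ∘ ≡.sym)) e) (λ e → y≢z , e)
            (between Uy Uz y≁z)
          where
          y≢z : y ≢ z
          y≢z refl = p≢q (trans (≡.sym ey) ez)
          -- A class sees x in a single colour, but y and z see it in `p` and `q`.
          y≁z : ¬ y ~ z
          y≁z y~z = p≢q (trans (≡.sym ey) (trans (C-sym λ { refl → x≁y ~-refl })
            (trans (same y~z Ux (x≁y ∘ ~-sym)) (trans (C-sym λ { refl → x≁z ~-refl }) ez))))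
      finish : Dec (12 + 4 * μ ≤ # (nbr? p)) → Dec (12 + 4 * μ ≤ # (nbr? q)) → ⊥
      finish (yes h) _ = sparse B (nbr? p) proj₁ (λ (_ , x≁z , _) → degree p x≁z) h
      finish _ (yes h) = sparse (swap B) (nbr? q) proj₁ (λ (_ , x≁z , _) → degree q x≁z) h
      finish (no h₁) (no h₂) = rectangle μ (≰⇒≤ h₁) (≰⇒≤ h₂) total edges

  -- Sets that every outside vertex sees in one colour

  Outer : Pred (Fin N) 0ℓ → Fin N → Fin (2 + κ) → Pred (Fin N) 0ℓ
  Outer W w x v = ¬ W v × C v w ≡ x

  outer? : ∀ {W} → Decidable W → ∀ w x → Decidable (Outer W w x)
  outer? W? w x v = ¬? (W? v) ×-dec (C v w ≟ x)

  -- Edges of the relation stay inside `W`, so each vertex outside is alone in its class.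
  conn⇒≡∨both : ∀ {W p q x y} → Conn W p q x y → x ≡ y ⊎ (W x × W y)
  conn⇒≡∨both ε = inj₁ refl
  conn⇒≡∨both ((Wx , Wa , _) ◅ es) with conn⇒≡∨both es
  ... | inj₁ refl     = inj₂ (Wx , Wa)
  ... | inj₂ (_ , Wy) = inj₂ (Wx , Wy)

  module Homogeneous {W : Pred (Fin N) 0ℓ} (W? : Decidable W)
    (homogeneous : ∀ {v w w′} → ¬ W v → W w → W w′ → C v w ≡ C v w′)
    (large : 3 + μ ≤ # W?) (w : Fin N) (Ww : W w) where

    outside≢ : ∀ {u v} → ¬ W u → W v → u ≢ v
    outside≢ ¬Wu Wv refl = ¬Wu Wv

    outer-joined : ∀ {x u v} → Outer W w x u → W v → Joined x u v
    outer-joined (¬Wu , e) Wv = outside≢ ¬Wu Wv , trans (homogeneous ¬Wu Wv Ww) e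

    -- Three such vertices would form K_{3,m} with the at least 3 + μ vertices of `W`.
    outer≤2 : ∀ x → # (outer? W? w x) ≤ 2
    outer≤2 x = ≰⇒≤ λ three →
      let a , b , d , Ta , Tb , Td , a≢b , b≢d , a≢d = pick3 (outer? W? w x) three
      in ℕₚ.<⇒≱ large (forbid W? a≢b b≢d a≢d λ Wv →
           outer-joined Ta Wv , outer-joined Tb Wv , outer-joined Td Wv)

    N≤ : N ≤ # W? + (2 + κ) * 2
    N≤ = begin
      N                                       ≤⟨ #-complement W? ⟩
      # W? + # (λ v → ¬? (W? v))              ≤⟨ ℕₚ.+-monoʳ-≤ (# W?) (#-fibres (λ v → ¬? (W? v)) (λ v → C v w)) ⟩
      # W? + sum (λ x → # (outer? W? w x))    ≤⟨ ℕₚ.+-monoʳ-≤ (# W?) (sum-mono-≤ outer≤2) ⟩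
      # W? + sum {2 + κ} (λ _ → 2)            ≡⟨ cong (# W? +_) (sum-const (2 + κ) 2) ⟩
      # W? + (2 + κ) * 2                      ∎
      where open ℕₚ.≤-Reasoning

    module Inner {p q} (p≢q : p ≢ q)
      (small : ∀ {x} → W x → # (λ y → W? y ×-dec conn? {p = p} {q} W? x y) ≤ 2) where

      inner : Blocks W p q
      inner = record
        { U? = W? ; p≢q = p≢q ; _~_ = Conn W p q ; _~?_ = conn? W?
        ; ~-refl = ε ; ~-sym = conn-sym
        ; between = cross ; same = uniform ; small = small }

      -- The two outside vertices see all of `W` in colour `t`, so `t`-neighbours of x in `W` are
      -- common to three vertices.
      sparseColour : ∀ {t} → 2 ≤ # (outer? W? w t) →
        ∀ {x} → W x → # (λ z → W? z ×-dec joined? t x z) ≤ 2 + μ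
      sparseColour {t} two {x} Wx =
        let a , b , Ta , Tb , a≢b = pick2 (outer? W? w t) two
        in forbid (λ z → W? z ×-dec joined? t x z)
             a≢b (outside≢ (proj₁ Tb) Wx) (outside≢ (proj₁ Ta) Wx) λ (Wz , j) →
               outer-joined Ta Wz , outer-joined Tb Wz , j

      U : Pred (Fin N) 0ℓ
      U v = W v ⊎ (¬ W v × (C v w ≡ p ⊎ C v w ≡ q))

      extended? : Decidable U
      extended? v = W? v ⊎-dec (¬? (W? v) ×-dec ((C v w ≟ p) ⊎-dec (C v w ≟ q)))

      unique : ∀ {t x y} → # (outer? W? w t) ≤ 1 → Outer W w t x → Outer W w t y → x ≡ y
      unique {t} {x} {y} ≤1 Tx Ty = decidable-stable (x ≟ y) λ x≢y → ℕₚ.<⇒≱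
        (ℕₚ.≤-trans
          (ℕₚ.≤-reflexive (≡.sym (cong₂ _+_ (#-≟ x) (#-≟ y))))
          (#-disjoint (_≟ x) (_≟ y) (outer? W? w t) (λ { refl → Tx }) (λ { refl → Ty })
            (λ { i refl e → x≢y e })))
        ≤1

      -- Added vertices are singleton classes. By the hypotheses two of them see `W` in different
      -- colours, so their triangle with `w` forces the edge between them to have colour `p` or `q`.
      outer : # (outer? W? w p) ≤ 1 → # (outer? W? w q) ≤ 1 → Blocks U p q
      outer p≤1 q≤1 = record
        { U? = extended? ; p≢q = p≢q ; _~_ = Conn W p q ; _~?_ = conn? W?
        ; ~-refl = ε ; ~-sym = conn-sym
        ; between = between ; same = same ; small = small′ }
        where
        PQ : Fin (2 + κ) → Set
        PQ x = x ≡ p ⊎ x ≡ q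

        via : ∀ {x y} → x ≡ y → PQ y → PQ x
        via refl h = h

        mixed : ∀ {x y} → ¬ W x → ¬ W y → C x w ≢ C y w → x ≢ y → PQ (C x w) → PQ (C y w) → PQ (C x y)
        mixed ¬Wx ¬Wy ne x≢y Px Py
          with triangle (outside≢ ¬Wx Ww) (outside≢ ¬Wy Ww ∘ ≡.sym) x≢y
                 (λ e → ne (trans e (C-sym (outside≢ ¬Wy Ww ∘ ≡.sym))))
        ... | inj₁ e = via e Px
        ... | inj₂ e = via (trans e (C-sym (outside≢ ¬Wy Ww ∘ ≡.sym))) Py

        between : ∀ {x y} → U x → U y → ¬ Conn W p q x y → PQ (C x y)
        between (inj₁ Wx) (inj₁ Wy) x≁y = cross Wx Wy x≁y
        between (inj₂ (¬Wx , Px)) (inj₁ Wy) x≁y = via (homogeneous ¬Wx Wy Ww) Px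
        between (inj₁ Wx) (inj₂ (¬Wy , Py)) x≁y =
          via (trans (C-sym (apart x≁y)) (homogeneous ¬Wy Wx Ww)) Py
        between (inj₂ (¬Wx , inj₁ e)) (inj₂ (¬Wy , inj₁ e′)) x≁y =
          ⊥-elim (apart x≁y (unique p≤1 (¬Wx , e) (¬Wy , e′)))
        between (inj₂ (¬Wx , inj₂ e)) (inj₂ (¬Wy , inj₂ e′)) x≁y =
          ⊥-elim (apart x≁y (unique q≤1 (¬Wx , e) (¬Wy , e′)))
        between (inj₂ (¬Wx , inj₁ e)) (inj₂ (¬Wy , inj₂ e′)) x≁y =
          mixed ¬Wx ¬Wy (λ f → p≢q (trans (≡.sym e) (trans f e′))) (apart x≁y) (inj₁ e) (inj₂ e′)
        between (inj₂ (¬Wx , inj₂ e)) (inj₂ (¬Wy , inj₁ e′)) x≁y =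
          mixed ¬Wx ¬Wy (λ f → p≢q (trans (≡.sym e′) (trans (≡.sym f) e))) (apart x≁y) (inj₂ e) (inj₁ e′)

        same : ∀ {x x′ y} → Conn W p q x x′ → U y → ¬ Conn W p q x y → C x y ≡ C x′ y
        same x~x′ (inj₁ Wy) x≁y = uniform x~x′ Wy x≁y
        -- A class with two elements lies in `W`, which the added vertex sees in one colour.
        same x~x′ (inj₂ (¬Wy , _)) x≁y with conn⇒≡∨both x~x′
        ... | inj₁ refl = refl
        ... | inj₂ (Wx , Wx′) = trans (C-sym (apart x≁y))
          (trans (homogeneous ¬Wy Wx Wx′) (C-sym (outside≢ ¬Wy Wx′)))

        small′ : ∀ {x} → U x → # (λ y → extended? y ×-dec conn? {p = p} {q} W? x y) ≤ 2
        small′ {x} (inj₁ Wx) = ℕₚ.≤-trans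
          (#-mono (λ y → extended? y ×-dec conn? W? x y) (λ y → W? y ×-dec conn? W? x y)
            λ (_ , x~y) → [ (λ { refl → Wx }) , proj₂ ]′ (conn⇒≡∨both x~y) , x~y)
          (small Wx)
        small′ {x} (inj₂ (¬Wx , _)) = ℕₚ.≤-trans
          (#-mono (λ y → extended? y ×-dec conn? W? x y) (_≟ x)
            λ (_ , x~y) → [ ≡.sym , (λ h → ⊥-elim (¬Wx (proj₁ h))) ]′ (conn⇒≡∨both x~y))
          (ℕₚ.m≤n⇒m≤1+n (#-singleton≤1 x))

      -- The vertices left out see `W` in one of the κ other colours, at most two for each.
      N≤extended : N ≤ # extended? + κ * 2
      N≤extended = begin
        N                       ≤⟨ #-complement extended? ⟩
        # extended? + # rest?   ≤⟨ ℕₚ.+-monoʳ-≤ (# extended?) (#-fibres rest? (λ v → C v w)) ⟩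
        # extended? + sum (λ x → # (fibre? x))
          ≤⟨ ℕₚ.+-monoʳ-≤ (# extended?) (sum-two-vanish p≢q (λ x → # (fibre? x))
               (#-none (fibre? p) λ v (h , e) → h (inj₂ (h ∘ inj₁ , inj₁ e)))
               (#-none (fibre? q) λ v (h , e) → h (inj₂ (h ∘ inj₁ , inj₂ e)))
               λ x → ℕₚ.≤-trans
                 (#-mono (fibre? x) (outer? W? w x) λ (h , e) → h ∘ inj₁ , e) (outer≤2 x)) ⟩
        # extended? + κ * 2     ∎
        where
        open ℕₚ.≤-Reasoning
        rest? : Decidable (λ v → ¬ U v)
        rest? v = ¬? (extended? v)
        fibre? : ∀ x → Decidable (λ v → ¬ U v × C v w ≡ x)
        fibre? x v = rest? v ×-dec (C v w ≟ x)

  -- Descent to a minimal homogeneous set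

  module _ (N≥₁ : 16 + 6 * μ + κ * 2 ≤ N) (N≥₂ : r + κ * 2 ≤ N) where

    -- Induction on a bound for the size of `W` replaces the choice of a minimal set: a class that
    -- is large enough takes the place of `W`.
    descend : ∀ fuel {W : Pred (Fin N) 0ℓ} (W? : Decidable W) →
      (∀ {v w w′} → ¬ W v → W w → W w′ → C v w ≡ C v w′) →
      3 + μ ≤ # W? → # W? ≤ fuel → ⊥
    descend zero W? hom large ≤fuel with ℕₚ.≤-trans large ≤fuel
    ... | ()
    descend (suc fuel) {W} W? hom large ≤fuel =
      let w , w′ , Ww , Ww′ , w≢w′ = pick2 W? (ℕₚ.≤-trans (ℕₚ.m≤m+n 2 (1 + μ)) large)
      in handle w Ww (gallai W? Ww Ww′ w≢w′)
      where
      handle : ∀ w → W w → Split W → ⊥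
      handle w Ww (p , q , p≢q , x₀ , y₀ , Wx₀ , Wy₀ , x₀≁y₀) =
        byClasses (any? λ x → W? x ×-dec (3 + μ ≤? # (class? x)))
                  (any? λ x → W? x ×-dec (3 ≤? # (class? x)))
        where
        open Homogeneous W? hom large w Ww

        class? : ∀ x → Decidable (λ y → W y × Conn W p q x y)
        class? x y = W? y ×-dec conn? W? x y

        -- At most two vertices per colour lie outside; the colours `p` and `q` account for the loss
        -- of 4 from 16 + 6μ.
        W≥ : 12 + 6 * μ ≤ # W?
        W≥ = ℕₚ.+-cancelʳ-≤ (4 + κ * 2) _ _ (ℕₚ.≤-trans
          (ℕₚ.≤-trans (ℕₚ.≤-reflexive (arith μ κ)) N≥₁) N≤)
          where
          arith : ∀ μ κ → 12 + 6 * μ + (4 + κ * 2) ≡ 16 + 6 * μ + κ * 2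
          arith = solve-∀

        -- Vertices of `W` outside the class see it in one colour by uniformity, the others by
        -- `hom`. It is smaller than `W`, since it misses `x₀` or `y₀`.
        largeClass : ∀ {x} → W x → 3 + μ ≤ # (class? x) → ⊥
        largeClass {x} Wx big =
          descend fuel (class? x) hom′ big (ℕₚ.≤-pred (ℕₚ.≤-trans smaller ≤fuel))
          where
          hom′ : ∀ {v u u′} → ¬ (W v × Conn W p q x v) → W u × Conn W p q x u →
                 W u′ × Conn W p q x u′ → C v u ≡ C v u′
          hom′ {v} v∉ (Wu , x~u) (Wu′ , x~u′) with W? v
          ... | no ¬Wv = hom ¬Wv Wu Wu′
          ... | yes Wv =
            let u≁v  = λ u~v → v∉ (Wv , x~u ◅◅ u~v)
                u′≁v = λ u′~v → v∉ (Wv , x~u′ ◅◅ u′~v)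
            in trans (C-sym (apart u≁v ∘ ≡.sym))
              (trans (uniform (conn-sym x~u ◅◅ x~u′) Wv u≁v) (C-sym (apart u′≁v)))
          missed : ∃ λ z → W z × ¬ Conn W p q x z
          missed with conn? {p = p} {q} W? x x₀
          ... | no x≁x₀  = x₀ , Wx₀ , x≁x₀
          ... | yes x~x₀ = y₀ , Wy₀ , λ x~y₀ → x₀≁y₀ (conn-sym x~x₀ ◅◅ x~y₀)
          smaller : suc (# (class? x)) ≤ # W?
          smaller = let z , Wz , x≁z = missed in ℕₚ.≤-trans
            (ℕₚ.≤-reflexive (cong (_+ # (class? x)) (≡.sym (#-≟ z))))
            (#-disjoint (_≟ z) (class? x) W? (λ { refl → Wz }) proj₁
              (λ { i refl (_ , x~z) → x≁z x~z }))

        -- Three vertices of the class share their neighbours outside it, so the class and its two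
        -- neighbourhoods have at most 2 + μ vertices each, too few for `W`.
        mediumClass : ∀ {x} → W x → 3 ≤ # (class? x) → # (class? x) ≤ 2 + μ → ⊥
        mediumClass {x} Wx three ≤m = overflow (5 + 3 * μ) (count μ) (ℕₚ.≤-trans W≥
          (ℕₚ.≤-trans (#-mono W? (class? x ∪? nbr? p ∪? nbr? q) cover) (≤m ⊕ nbrs p ⊕ nbrs q)))
          where
          nbr? : ∀ t → Decidable (λ v → W v × ¬ Conn W p q x v × C x v ≡ t)
          nbr? t v = W? v ×-dec ¬? (conn? W? x v) ×-dec (C x v ≟ t)
          nbrs : ∀ t → # (nbr? t) ≤ 2 + μ
          nbrs t =
            let a , b , d , (_ , x~a) , (_ , x~b) , (_ , x~d) , a≢b , b≢d , a≢d = pick3 (class? x) three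
                join : ∀ {z v} → Conn W p q x z → W v × ¬ Conn W p q x v × C x v ≡ t → Joined t z v
                join = λ x~z (Wv , x≁v , e) →
                  (λ { refl → x≁v x~z }) , trans (≡.sym (uniform x~z Wv x≁v)) e
            in forbid (nbr? t) a≢b b≢d a≢d λ h → join x~a h , join x~b h , join x~d h
          cover : ∀ {v} → W v → (W v × Conn W p q x v) ⊎
                  ((W v × ¬ Conn W p q x v × C x v ≡ p) ⊎ (W v × ¬ Conn W p q x v × C x v ≡ q))
          cover {v} Wv = byClass (conn? W? x v)
            where
            byClass : Dec (Conn W p q x v) → _
            byClass (yes h)  = inj₁ (Wv , h)
            byClass (no x≁v) = inj₂ (Sum.map (λ e → Wv , x≁v , e) (λ e → Wv , x≁v , e)
                                             (cross Wx Wv x≁v))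
          count : ∀ μ → 12 + 6 * μ ≡ suc ((2 + μ) + ((2 + μ) + (2 + μ)) + (5 + 3 * μ))
          count = solve-∀

        smallClasses : (∀ {x} → W x → # (class? x) ≤ 2) → ⊥
        smallClasses small = byOuter (2 ≤? # (outer? W? w p)) (2 ≤? # (outer? W? w q))
          where
          open Inner p≢q small
          W≥′ : 12 + 4 * μ ≤ # W?
          W≥′ = ℕₚ.≤-trans (ℕₚ.+-monoʳ-≤ 12 (ℕₚ.*-monoˡ-≤ μ (ℕₚ.m≤m+n 4 2))) W≥
          byOuter : Dec (2 ≤ # (outer? W? w p)) → Dec (2 ≤ # (outer? W? w q)) → ⊥
          byOuter (yes two) _ = sparse inner W? id (sparseColour two) W≥′
          byOuter _ (yes two) = sparse (swap inner) W? id (sparseColour two) W≥′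
          byOuter (no p<2) (no q<2) = noBlocks (outer (≰⇒≤ p<2) (≰⇒≤ q<2))
            (ℕₚ.+-cancelʳ-≤ (κ * 2) _ _ (ℕₚ.≤-trans N≥₁ N≤extended))
            (ℕₚ.+-cancelʳ-≤ (κ * 2) _ _ (ℕₚ.≤-trans N≥₂ N≤extended))

        byClasses : Dec (∃ λ x → W x × 3 + μ ≤ # (class? x)) →
                    Dec (∃ λ x → W x × 3 ≤ # (class? x)) → ⊥
        byClasses (yes (x , Wx , big)) _ = largeClass Wx big
        byClasses (no none) (yes (x , Wx , three)) =
          mediumClass Wx three (≰⇒≤ λ big → none (x , Wx , big))
        byClasses (no _) (no none) = smallClasses λ Wx → ≰⇒≤ λ three → none (_ , Wx , three)

    contradiction : ⊥
    -- The descent starts from the whole vertex set, which is homogeneous because nothing lies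
    -- outside.
    contradiction = descend N univ? (λ ¬tt → ⊥-elim (¬tt tt))
      (ℕₚ.≤-trans m≤N (ℕₚ.≤-reflexive (≡.sym (#-all {n = N} univ? (λ _ → tt)))))
      (ℕₚ.≤-reflexive (#-all {n = N} univ? (λ _ → tt)))
      where
      m≤N : 3 + μ ≤ N
      m≤N = begin
        3 + μ                              ≤⟨ ℕₚ.m≤m+n (3 + μ) (13 + 5 * μ + κ * 2) ⟩
        3 + μ + (13 + 5 * μ + κ * 2)       ≡⟨ arith μ κ ⟩
        16 + 6 * μ + κ * 2                 ≤⟨ N≥₁ ⟩
        N                                  ∎
        where
        open ℕₚ.≤-Reasoning
        arith : ∀ μ κ → 3 + μ + (13 + 5 * μ + κ * 2) ≡ 16 + 6 * μ + κ * 2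
        arith = solve-∀

upperBound : ∀ κ μ {r} → RamseyProp (3 + μ) r →
             GRProp (2 + κ) (3 + μ) (((6 * (3 + μ) ∸ 2) ⊔ r) + 2 * κ)
upperBound κ μ {r} ramsey N G≤N c _ with hasRainbow? c | hasMono? (3 + μ) c
... | yes rb | _        = inj₁ rb
... | no _   | yes mono = inj₂ mono
... | no ¬rb | no ¬mono = ⊥-elim (Upper.contradiction c ¬rb ¬mono ramsey
        (room (ℕₚ.≤-trans (ℕₚ.≤-reflexive 6m-2) (ℕₚ.m≤m⊔n (6 * (3 + μ) ∸ 2) r)))
        (room (ℕₚ.m≤n⊔m (6 * (3 + μ) ∸ 2) r)))
  where
  6m-2 : 16 + 6 * μ ≡ 6 * (3 + μ) ∸ 2
  6m-2 = cong (_∸ 2) (expand μ)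
    where
    expand : ∀ μ → 18 + 6 * μ ≡ 6 * (3 + μ)
    expand = solve-∀
  room : ∀ {s} → s ≤ (6 * (3 + μ) ∸ 2) ⊔ r → s + κ * 2 ≤ N
  room s≤ = ℕₚ.≤-trans (ℕₚ.+-mono-≤ s≤ (ℕₚ.≤-reflexive (ℕₚ.*-comm κ 2))) G≤N

ramseyNumber : ∀ m → ∃ (IsRamseyK3m m)
ramseyNumber m = least (ramseyProp? m) (chainSize m 5) (large⇒ramsey ℕₚ.≤-refl)

theorem15 : (k m : ℕ) → 3 ≤ k → 3 ≤ m →
    Σ ℕ λ r → Σ ℕ λ g → IsRamseyK3m m r × IsGR k m g ×
    (r + 2 * (k ∸ 2) ≤ g) × (g ≤ ((6 * m ∸ 2) ⊔ r) + 2 * (k ∸ 2))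
theorem15 (suc (suc κ)) (suc (suc (suc μ))) (s≤s (s≤s _)) 3≤m@(s≤s (s≤s (s≤s _))) =
  withRamsey (ramseyNumber (3 + μ))
  where
  withRamsey : ∃ (IsRamseyK3m (3 + μ)) → _
  withRamsey (r , isR) =
    -- The upper bound is also the point from which the search for the least `g` descends.
    let g , isGR , g≤ = grLeast (((6 * (3 + μ) ∸ 2) ⊔ r) + 2 * κ) (upperBound κ μ (proj₁ isR))
    in r , g , isR , isGR ,
       ℕₚ.≤-trans (ℕₚ.+-monoʳ-≤ r (ℕₚ.≤-reflexive (ℕₚ.*-comm 2 κ))) (lowerBound 3≤m κ isR (proj₁ isGR)) ,
       g≤
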